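{- Let $G$ be a connected finite simple graph with maximum degree $\Delta(G)$. Then $\chi_{D_L}(G)\leq 2\Delta(G)-1$, unless $G$ is the complete bipartite graph $K_{\Delta(G),\Delta(G)}$ or the cycle $C_6$. In these two cases, $\chi_{D_L}(G)=2\Delta(G)$.
   Context: A vertex coloring $f$ of a graph $G$ is distinguishing if the only automorphism $\phi$ of $G$ with $f(\phi(v))=f(v)$ for all vertices $v$ is the identity. A list assignment $L=\{L(v)\}_{v\in V(G)}$ assigns to each vertex a finite set of colors; $G$ is properly $L$-distinguishable if there is a proper vertex coloring $f$ of $G$ which is distinguishing and satisfies $f(v)\in L(v)$ for all $v$. The list-distinguishing chromatic number $\chi_{D_L}(G)$ is the minimum integer $k$ such that $G$ is properly $L$-distinguishable for every list assignment $L$ with $|L(v)|=k$ for all $v\in V(G)$. $C_6$ is the cycle on six vertices and $K_{m,m}$ the complete bipartite graph with both parts of size $m$.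
   Formalization: The graph is assumed to have at least two vertices, since for the one-vertex graph (maximum degree 0, list-distinguishing chromatic number 1) the bound 2Δ(G)−1 fails although it is neither exceptional graph. -}

module Defs where

open import Data.Nat using (ℕ; zero; suc; _+_; _*_; _∸_; _≤_; _<_; _⊔_)
open import Data.Nat.Properties using (_≟_)
open import Data.Bool using (Bool; true; false; if_then_else_; _∧_; _∨_)
open import Data.Fin using (Fin; toℕ)
open import Data.List using (List; length; map; foldr; allFin)
open import Data.Nat.ListAction using (sum)
open import Data.List.Relation.Unary.Unique.Propositional using (Unique)
open import Data.List.Membership.Propositional using (_∈_)
open import Data.Product using (Σ; ∃; _×_; _,_)
open import Function.Bundles using (_↔_; Inverse)
open import Relation.Binary.PropositionalEquality using (_≡_; _≢_)
open import Relation.Nullary using (¬_; does)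
open import Data.Nat using (_<ᵇ_; _≡ᵇ_)

record Graph : Set where
  field
    n      : ℕ
    adj    : Fin n → Fin n → Bool
    sym    : ∀ u v → adj u v ≡ adj v u
    irrefl : ∀ v → adj v v ≡ false
open Graph public

Edge : (G : Graph) → Fin (n G) → Fin (n G) → Set
Edge G u v = adj G u v ≡ true

degree : (G : Graph) → Fin (n G) → ℕ
degree G v = sum (map (λ u → if adj G v u then 1 else 0) (allFin (n G)))

maxDegree : (G : Graph) → ℕ
maxDegree G = foldr _⊔_ 0 (map (degree G) (allFin (n G)))

data Reachable (G : Graph) : Fin (n G) → Fin (n G) → Set where
  here : ∀ {v} → Reachable G v v
  step : ∀ {u w v} → Edge G u w → Reachable G w v → Reachable G u v

Connected : Graph → Set
Connected G = ∀ u v → Reachable G u v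

Isomorphic : Graph → Graph → Set
Isomorphic G H =
  Σ (Fin (n G) ↔ Fin (n H)) λ φ →
    ∀ u v → adj G u v ≡ adj H (Inverse.to φ u) (Inverse.to φ v)

Automorphism : (G : Graph) → (Fin (n G) ↔ Fin (n G)) → Set
Automorphism G φ = ∀ u v → adj G u v ≡ adj G (Inverse.to φ u) (Inverse.to φ v)

Coloring : Graph → Set
Coloring G = Fin (n G) → ℕ

Proper : (G : Graph) → Coloring G → Set
Proper G f = ∀ u v → Edge G u v → f u ≢ f v

Distinguishing : (G : Graph) → Coloring G → Set
Distinguishing G f =
  ∀ (φ : Fin (n G) ↔ Fin (n G)) → Automorphism G φ →
    (∀ v → f (Inverse.to φ v) ≡ f v) → ∀ v → Inverse.to φ v ≡ v

ListAssignment : Graph → Set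
ListAssignment G = Fin (n G) → List ℕ

HasSize : (G : Graph) → ListAssignment G → ℕ → Set
HasSize G L k = ∀ v → Unique (L v) × length (L v) ≡ k

ProperlyLDistinguishable : (G : Graph) → ListAssignment G → Set
ProperlyLDistinguishable G L =
  Σ (Coloring G) λ f → Proper G f × Distinguishing G f × (∀ v → f v ∈ L v)

ListDist : Graph → ℕ → Set
ListDist G k = ∀ (L : ListAssignment G) → HasSize G L k → ProperlyLDistinguishable G L

IsChiDL : Graph → ℕ → Set
IsChiDL G m = ListDist G m × (∀ k → k < m → ¬ ListDist G k)

Kmm : ℕ → Graph
Kmm m = record
  { n = m + m
  ; adj = λ u v → xorB (toℕ u <ᵇ m) (toℕ v <ᵇ m)
  ; sym = λ u v → xor-comm (toℕ u <ᵇ m) (toℕ v <ᵇ m)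
  ; irrefl = λ v → xor-self (toℕ v <ᵇ m)
  }
  where
  open import Data.Bool using () renaming (_xor_ to xorB)
  open import Relation.Binary.PropositionalEquality using (refl)
  xor-comm : ∀ a b → xorB a b ≡ xorB b a
  xor-comm true true = refl
  xor-comm true false = refl
  xor-comm false true = refl
  xor-comm false false = refl
  xor-self : ∀ a → xorB a a ≡ false
  xor-self true = refl
  xor-self false = refl

C6 : Graph
C6 = record { n = 6 ; adj = a ; sym = s ; irrefl = r }
  where
  open import Data.Nat.DivMod using (_%_)
  open import Relation.Binary.PropositionalEquality using (refl)
  a : Fin 6 → Fin 6 → Bool
  a u v = ((suc (toℕ u) % 6) ≡ᵇ toℕ v) ∨ ((suc (toℕ v) % 6) ≡ᵇ toℕ u)
  s : ∀ u v → a u v ≡ a v u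
  s u v with (suc (toℕ u) % 6) ≡ᵇ toℕ v | (suc (toℕ v) % 6) ≡ᵇ toℕ u
  ... | true | true = refl
  ... | true | false = refl
  ... | false | true = refl
  ... | false | false = refl
  r : ∀ v → a v v ≡ false
  r Fin.zero = refl
  r (Fin.suc Fin.zero) = refl
  r (Fin.suc (Fin.suc Fin.zero)) = refl
  r (Fin.suc (Fin.suc (Fin.suc Fin.zero))) = refl
  r (Fin.suc (Fin.suc (Fin.suc (Fin.suc Fin.zero)))) = refl
  r (Fin.suc (Fin.suc (Fin.suc (Fin.suc (Fin.suc Fin.zero))))) = refl

-- Fix an edge r v and a search order of the vertices starting with r, v, in which every later vertex has an
-- earlier neighbour; the earliest neighbour of w is its parent.  If r has a colour of its own, adjacent vertices
-- get different colours and so do siblings, then a colour-preserving automorphism fixes r and, going down the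
-- tree, everything.  So it is enough to colour the graph H on the vertices other than r which joins neighbours
-- and siblings.  Its degrees are at most 2Δ − 2, and removing the colour of r leaves lists of size 2Δ − 2 (2Δ − 1
-- if the lists have size 2Δ).  Colouring against the search order, only v can fail, and only if G is regular and
-- triangle-free and all lists are equal; then H is to be coloured as in Brooks' theorem.  If this fails, the
-- uncoloured vertex can be slid along the edges of H like the hole of a sliding puzzle, and the colours around
-- the hole are always pairwise different.  Unless G = K_{Δ,Δ}, there are nonadjacent x ∈ N(v) and y ∈ N(r); for
-- Δ ≥ 3, moving the hole from v through x to y and back, before and after exchanging the colours of y and another
-- neighbour of r, gives a contradiction.  For Δ = 2 the colour of r can be reused at distance two from v, unless
-- G = C₆.
--
-- The value is attained because the property of k is decidable: colours can be renamed into a bounded range.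
module Submission where

open import Defs hiding (sym)
open import Data.Bool using (Bool; true; false; if_then_else_; _xor_)
import Data.Bool.Properties as Boolₚ
open import Data.Empty using (⊥; ⊥-elim)
open import Data.Fin using (Fin; zero; suc; toℕ; fromℕ<; splitAt; join; _↑ˡ_; _↑ʳ_)
import Data.Fin as Fin
open import Data.Fin.Permutation using (transpose)
open import Data.Fin.Properties
  using (_≟_; any?; all?; pigeonhole; toℕ-fromℕ<; <⇒≢; toℕ-↑ˡ; toℕ-↑ʳ; toℕ<n; splitAt-↑ˡ; splitAt-↑ʳ; join-splitAt)
open import Data.List
  using (List; []; _∷_; _++_; length; map; filter; foldr; allFin; lookup; concatMap; upTo; cartesianProductWith)
open import Data.List.Membership.Propositional using (_∈_; _∉_; lose; find)
import Data.List.Membership.DecPropositional as DecMembership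
open import Data.List.Membership.Propositional.Properties
  using ( ∈-∃++; ∈-++⁻; ∈-++⁺ˡ; ∈-++⁺ʳ; ∈-allFin; ∈-filter⁺; ∈-filter⁻; ∈-map⁺; ∈-map⁻; ∈-lookup; ∈-concatMap⁺
        ; ∈-cartesianProductWith⁺; ∈-cartesianProductWith⁻; ∈-upTo⁺; ∈-upTo⁻)
open import Data.List.Properties using (length-map; length-++; filter-notAll; length-tabulate; length-upTo)
open import Data.List.Relation.Unary.All using ([]; _∷_) renaming (lookup to All-lookup; tabulate to All-tabulate)
open import Data.List.Relation.Unary.AllPairs using ([]; _∷_)
open import Data.List.Relation.Unary.Any using (Any; here; there; index) renaming (any? to Any?)
open import Data.List.Relation.Unary.Any.Properties using (lookup-index)
open import Data.List.Relation.Unary.Unique.Propositional using (Unique)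
open import Data.List.Relation.Unary.Unique.Propositional.Properties
  using (allFin⁺; filter⁺; map⁺; upTo⁺; Unique[x∷xs]⇒x∉xs)
open import Data.Nat using (ℕ; zero; suc; _+_; _*_; _∸_; _≤_; _<_; _⊔_; z≤n; s≤s; _<?_; _<ᵇ_)
open import Data.Nat.Induction using (<-wellFounded)
open import Data.Nat.ListAction using (sum)
open import Data.Nat.Properties as ℕₚ
  using (≤-trans; ≤-refl; <-irrefl; <-trans; ≤-<-trans; <-≤-trans; m≤m⊔n; m≤n⊔m; +-suc; n<1+n)
open import Data.List.Relation.Unary.Unique.DecPropositional ℕₚ._≟_ using (unique?)
open import Data.Product using (Σ; ∃; _×_; _,_; proj₁; proj₂)
open import Data.Sum using (_⊎_; inj₁; inj₂; [_,_]′) renaming (map to ⊎-map)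
open import Data.Vec.Functional using () renaming (_∷_ to _∷ᶠ_)
open import Function using (_∘_; id)
open import Function.Bundles using (_↔_; Inverse; mk↔ₛ′)
open import Induction.WellFounded using (Acc; acc)
open import Relation.Binary.Definitions using (DecidableEquality)
open import Relation.Binary.PropositionalEquality
  using (_≡_; _≢_; refl; sym; trans; cong; cong₂; subst; subst₂; ≢-sym)
open import Relation.Nullary using (¬_; Dec; yes; no; ¬?; contradiction)
open import Relation.Nullary.Decidable
  using (_×-dec_; _⊎-dec_; _→-dec_; ¬¬-excluded-middle; map′; decidable-stable; from-yes)
open import Relation.Unary using (Decidable)

-- Counting in duplicate-free lists

length-unique-⊆ : {A : Set} {xs ys : List A} → Unique xs → (∀ {x} → x ∈ xs → x ∈ ys) →
  length xs ≤ length ys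
length-unique-⊆ {xs = []} _ _ = z≤n
length-unique-⊆ {xs = x ∷ xs} (x∉ ∷ u) xs⊆ys with ∈-∃++ (xs⊆ys (here refl))
... | as , bs , refl = subst (suc (length xs) ≤_) (sym len) (s≤s (length-unique-⊆ u sub))
  where
  len : length (as ++ x ∷ bs) ≡ suc (length (as ++ bs))
  len = trans (length-++ as) (trans (+-suc (length as) (length bs)) (cong suc (sym (length-++ as))))
  sub : ∀ {y} → y ∈ xs → y ∈ as ++ bs
  sub y∈ with ∈-++⁻ as (xs⊆ys (there y∈))
  ... | inj₁ p = ∈-++⁺ˡ p
  ... | inj₂ (here refl) = ⊥-elim (All-lookup x∉ y∈ refl)
  ... | inj₂ (there p) = ∈-++⁺ʳ as p

module Removal {A : Set} (_≟_ : DecidableEquality A) where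

  infixl 6 _∖_
  _∖_ : List A → A → List A
  xs ∖ x = filter (λ y → ¬? (y ≟ x)) xs

  ∈-∖⁺ : ∀ {x y xs} → y ∈ xs → y ≢ x → y ∈ xs ∖ x
  ∈-∖⁺ {x} = ∈-filter⁺ (λ y → ¬? (y ≟ x))

  ∈-∖⁻ : ∀ {x y xs} → y ∈ xs ∖ x → y ∈ xs × y ≢ x
  ∈-∖⁻ {x} = ∈-filter⁻ (λ y → ¬? (y ≟ x))

  ∖-unique : ∀ {x xs} → Unique xs → Unique (xs ∖ x)
  ∖-unique {x} = filter⁺ (λ y → ¬? (y ≟ x))

  length-∖ : ∀ {x xs} → x ∈ xs → suc (length (xs ∖ x)) ≤ length xs
  length-∖ {x} {xs} x∈ = filter-notAll (λ y → ¬? (y ≟ x)) xs (lose x∈ (λ ne → ne refl))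

  length-∖-unique : ∀ {x xs} → Unique xs → length xs ≤ suc (length (xs ∖ x))
  length-∖-unique {x} {xs} u = length-unique-⊆ u sub
    where
    sub : ∀ {y} → y ∈ xs → y ∈ x ∷ xs ∖ x
    sub {y} y∈ with y ≟ x
    ... | yes e = here e
    ... | no ne = there (∈-∖⁺ y∈ ne)

  free-element : ∀ {xs} → Unique xs → (ys : List A) → length ys < length xs →
    ∃ λ x → x ∈ xs × x ∉ ys
  free-element {[]} _ ys ()
  free-element {x ∷ xs} (x∉ ∷ u) ys lt with DecMembership._∈?_ _≟_ x ys
  ... | no x∉ys = x , here refl , x∉ys
  ... | yes x∈ys with free-element u (ys ∖ x) (ℕₚ.≤-pred (≤-trans (s≤s (length-∖ x∈ys)) lt))
  ...   | y , y∈ , y∉ = y , there y∈ , λ y∈ys → y∉ (∈-∖⁺ y∈ys (λ e → All-lookup x∉ y∈ (sym e)))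

-- Predicates on a finite set

module _ {N : ℕ} {P : Fin N → Set} where

  count : Decidable P → ℕ
  count P? = length (filter P? (allFin N))

  count≤length : (P? : Decidable P) (ys : List (Fin N)) → (∀ {u} → P u → u ∈ ys) → count P? ≤ length ys
  count≤length P? ys sub =
    length-unique-⊆ (filter⁺ P? (allFin⁺ N)) (λ u∈ → sub (proj₂ (∈-filter⁻ P? {xs = allFin N} u∈)))

  count-mono : {Q : Fin N → Set} (P? : Decidable P) (Q? : Decidable Q) → (∀ {u} → P u → Q u) →
    count P? ≤ length (filter Q? (allFin N))
  count-mono P? Q? sub = count≤length P? _ (λ p → ∈-filter⁺ Q? (∈-allFin _) (sub p))

  -- Excluded middle under a double negation, used finitely often. It permits case distinctions on
  -- an inductively defined predicate such as `Reach` when the goal is `⊥`.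
  ¬¬-decidable : ¬ ¬ Decidable P
  ¬¬-decidable = shift P
    where
    shift : ∀ {m} (Q : Fin m → Set) → ¬ ¬ (∀ i → Dec (Q i))
    shift {zero} Q k = k (λ ())
    shift {suc m} Q k = ¬¬-excluded-middle λ d →
      shift (Q ∘ suc) λ ds → k λ { zero → d ; (suc i) → ds i }

  minimiser : Decidable P → (τ : Fin N → ℕ) → ∃ P → ∃ λ p → P p × (∀ u → P u → τ p ≤ τ u)
  minimiser P? τ (u₀ , pu₀) = go u₀ pu₀ (<-wellFounded (τ u₀))
    where
    go : ∀ u → P u → Acc _<_ (τ u) → ∃ λ p → P p × (∀ u → P u → τ p ≤ τ u)
    go u pu (acc rs) with any? (λ w → P? w ×-dec (τ w <? τ u))
    ... | yes (w , pw , lt) = go w pw (rs lt)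
    ... | no ¬∃ = u , pu , λ w pw → ℕₚ.≮⇒≥ (λ lt → ¬∃ (w , pw , lt))

-- Changing a function at one point

infixl 8 _[_≔_]
_[_≔_] : ∀ {N} {A : Set} → (Fin N → A) → Fin N → A → Fin N → A
(g [ z ≔ c ]) u with u ≟ z
... | yes _ = c
... | no _ = g u

module _ {N : ℕ} {A : Set} (g : Fin N → A) (z : Fin N) {c : A} where

  update-at : (g [ z ≔ c ]) z ≡ c
  update-at with z ≟ z
  ... | yes _ = refl
  ... | no ne = ⊥-elim (ne refl)

  update-off : ∀ {u} → u ≢ z → (g [ z ≔ c ]) u ≡ g u
  update-off {u} ne with u ≟ z
  ... | yes e = ⊥-elim (ne e)
  ... | no _ = refl

-- Neighbourhoods and degrees

module _ (G : Graph) where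

  edge? : ∀ v → Decidable (Edge G v)
  edge? v u = adj G v u Boolₚ.≟ true

  edge-sym : ∀ {u v} → Edge G u v → Edge G v u
  edge-sym {u} {v} e = trans (Graph.sym G v u) e

  edge-irrefl : ∀ {u v} → Edge G u v → u ≢ v
  edge-irrefl {u} e refl with trans (sym e) (irrefl G u)
  ... | ()

  nbrs : Fin (n G) → List (Fin (n G))
  nbrs v = filter (edge? v) (allFin (n G))

  ∈-nbrs⁺ : ∀ {v u} → Edge G v u → u ∈ nbrs v
  ∈-nbrs⁺ {v} e = ∈-filter⁺ (edge? v) (∈-allFin _) e

  ∈-nbrs⁻ : ∀ {v u} → u ∈ nbrs v → Edge G v u
  ∈-nbrs⁻ {v} u∈ = proj₂ (∈-filter⁻ (edge? v) {xs = allFin (n G)} u∈)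

  nbrs-unique : ∀ v → Unique (nbrs v)
  nbrs-unique v = filter⁺ (edge? v) (allFin⁺ (n G))

  degree≡length-nbrs : ∀ v → degree G v ≡ length (nbrs v)
  degree≡length-nbrs v = go (allFin (n G))
    where
    go : ∀ xs → sum (map (λ u → if adj G v u then 1 else 0) xs) ≡ length (filter (edge? v) xs)
    go [] = refl
    go (x ∷ xs) with adj G v x
    ... | true = cong suc (go xs)
    ... | false = go xs

  degree≤maxDegree : ∀ v → degree G v ≤ maxDegree G
  degree≤maxDegree v = go (allFin (n G)) (∈-allFin v)
    where
    go : ∀ xs → v ∈ xs → degree G v ≤ foldr _⊔_ 0 (map (degree G) xs)
    go (x ∷ xs) (here refl) = m≤m⊔n (degree G x) _
    go (x ∷ xs) (there p) = ≤-trans (go xs p) (m≤n⊔m (degree G x) _)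

  maxDegree≤ : ∀ {d} → (∀ v → degree G v ≤ d) → maxDegree G ≤ d
  maxDegree≤ {d} b = go (allFin (n G))
    where
    go : ∀ xs → foldr _⊔_ 0 (map (degree G) xs) ≤ d
    go [] = z≤n
    go (x ∷ xs) = ℕₚ.⊔-lub (b x) (go xs)

  length-nbrs≤ : ∀ v → length (nbrs v) ≤ maxDegree G
  length-nbrs≤ v = subst (_≤ maxDegree G) (degree≡length-nbrs v) (degree≤maxDegree v)

  reachable-ind : {P : Fin (n G) → Set} → (∀ {u w} → P u → Edge G u w → P w) →
    ∀ {u w} → Reachable G u w → P u → P w
  reachable-ind next here p = p
  reachable-ind next (step e ρ) p = reachable-ind next ρ (next p e)

-- Search trees

record SearchOrder (G : Graph) (r v : Fin (n G)) : Set where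
  field
    τ           : Fin (n G) → ℕ
    τ-injective : ∀ {u w} → τ u ≡ τ w → u ≡ w
    τ-bounded   : ∀ w → τ w < n G
    τ-root      : τ r ≡ 0
    τ-second    : τ v ≡ 1
    descent     : ∀ w → w ≢ r → ∃ λ u → Edge G w u × τ u < τ w

module _ (G : Graph) {r v : Fin (n G)} (rv : Edge G r v) where

  private V = Fin (n G)

  open DecMembership (_≟_ {n G}) using (_∈?_)

  -- The list is in reverse order of discovery.
  data Discovery : List V → Set where
    start    : Discovery (v ∷ r ∷ [])
    discover : ∀ {w u xs} → w ∉ xs → u ∈ xs → Edge G w u → Discovery xs → Discovery (w ∷ xs)

  -- The list is reversed, so the length of the tail behind `w` counts the vertices found before it.
  -- The value 0 off the list is a mere default: injectivity is claimed for members only.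
  rank : List V → V → ℕ
  rank [] w = 0
  rank (x ∷ xs) w with w ≟ x
  ... | yes _ = length xs
  ... | no _ = rank xs w

  rank-head : ∀ x xs → rank (x ∷ xs) x ≡ length xs
  rank-head x xs with x ≟ x
  ... | yes _ = refl
  ... | no ne = ⊥-elim (ne refl)

  rank-tail : ∀ {x w} xs → w ≢ x → rank (x ∷ xs) w ≡ rank xs w
  rank-tail {x} {w} xs ne with w ≟ x
  ... | yes e = ⊥-elim (ne e)
  ... | no _ = refl

  rank<length : ∀ {xs w} → w ∈ xs → rank xs w < length xs
  rank<length {x ∷ xs} {w} w∈ with w ≟ x | w∈
  ... | yes _ | _ = n<1+n _
  ... | no ne | here e = ⊥-elim (ne e)
  ... | no _ | there p = ≤-trans (rank<length p) (ℕₚ.n≤1+n _)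

  rank-injective : ∀ {xs u w} → u ∈ xs → w ∈ xs → rank xs u ≡ rank xs w → u ≡ w
  rank-injective {x ∷ xs} {u} {w} u∈ w∈ e with u ≟ x | w ≟ x | u∈ | w∈
  ... | yes p | yes q | _ | _ = trans p (sym q)
  ... | yes _ | no ne | _ | here q = ⊥-elim (ne q)
  ... | yes _ | no _ | _ | there q = ⊥-elim (<-irrefl (sym e) (rank<length q))
  ... | no ne | yes _ | here p | _ = ⊥-elim (ne p)
  ... | no _ | yes _ | there p | _ = ⊥-elim (<-irrefl e (rank<length p))
  ... | no ne | no _ | here p | _ = ⊥-elim (ne p)
  ... | no _ | no ne | there _ | here q = ⊥-elim (ne q)
  ... | no _ | no _ | there p | there q = rank-injective p q e

  fresh-≢ : ∀ {xs : List V} {u w} → w ∉ xs → u ∈ xs → u ≢ w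
  fresh-≢ w∉ u∈ refl = w∉ u∈

  ∈-discovered : ∀ {xs} → Discovery xs → r ∈ xs × v ∈ xs
  ∈-discovered start = there (here refl) , here refl
  ∈-discovered (discover _ _ _ D) = there (proj₁ (∈-discovered D)) , there (proj₂ (∈-discovered D))

  discovery-unique : ∀ {xs} → Discovery xs → Unique xs
  discovery-unique start = (≢-sym (edge-irrefl G rv) ∷ []) ∷ [] ∷ []
  discovery-unique (discover w∉ _ _ D) =
    All-tabulate (λ u∈ → ≢-sym (fresh-≢ w∉ u∈)) ∷ discovery-unique D

  rank-root : ∀ {xs} → Discovery xs → rank xs r ≡ 0
  rank-root start = trans (rank-tail (r ∷ []) (edge-irrefl G rv)) (rank-head r [])
  rank-root (discover {xs = xs} w∉ _ _ D) =
    trans (rank-tail xs (fresh-≢ w∉ (proj₁ (∈-discovered D)))) (rank-root D)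

  rank-second : ∀ {xs} → Discovery xs → rank xs v ≡ 1
  rank-second start = rank-head v (r ∷ [])
  rank-second (discover {xs = xs} w∉ _ _ D) =
    trans (rank-tail xs (fresh-≢ w∉ (proj₂ (∈-discovered D)))) (rank-second D)

  rank-descent : ∀ {xs w} → Discovery xs → w ∈ xs → w ≢ r →
    ∃ λ u → u ∈ xs × Edge G w u × rank xs u < rank xs w
  rank-descent start (here refl) _ = r , there (here refl) , edge-sym G rv ,
    subst₂ _<_ (sym (rank-root start)) (sym (rank-second start)) (n<1+n 0)
  rank-descent start (there (here refl)) ne = ⊥-elim (ne refl)
  rank-descent (discover {w} {u} {xs} w∉ u∈ wu D) (here refl) _ = u , there u∈ , wu ,
    subst₂ _<_ (sym (rank-tail xs (fresh-≢ w∉ u∈))) (sym (rank-head w xs)) (rank<length u∈)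
  rank-descent (discover {xs = xs} w∉ _ _ D) (there x∈) ne with rank-descent D x∈ ne
  ... | u , u∈ , xu , lt = u , there u∈ , xu ,
    subst₂ _<_ (sym (rank-tail xs (fresh-≢ w∉ u∈))) (sym (rank-tail xs (fresh-≢ w∉ x∈))) lt

  length≤n : ∀ {xs : List V} → Unique xs → length xs ≤ n G
  length≤n {xs} u = subst (length xs ≤_) (length-tabulate id) (length-unique-⊆ u (λ {x} _ → ∈-allFin x))

  -- Once no undiscovered vertex has a discovered neighbour, the list is closed under adjacency and
  -- contains everything by connectedness. The fuel `k` suffices because a duplicate-free list has
  -- at most `n G` entries.
  discover-all : Connected G → ∃ λ xs → Discovery xs × (∀ w → w ∈ xs)
  discover-all conn = grow (n G) start (ℕₚ.m≤m+n (n G) 2)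
    where
    grow : ∀ k {xs} → Discovery xs → n G ≤ k + length xs → ∃ λ ys → Discovery ys × (∀ w → w ∈ ys)
    grow k {xs} D fuel with any? (λ w → ¬? (w ∈? xs) ×-dec any? (λ u → (u ∈? xs) ×-dec edge? G w u))
    grow k {xs} D fuel | no ¬∃ = xs , D , λ w → reachable-ind G closed (conn r w) (proj₁ (∈-discovered D))
      where
      closed : ∀ {u w} → u ∈ xs → Edge G u w → w ∈ xs
      closed {u} {w} u∈ uw with w ∈? xs
      ... | yes w∈ = w∈
      ... | no w∉ = ⊥-elim (¬∃ (w , w∉ , u , u∈ , edge-sym G uw))
    grow zero D fuel | yes (w , w∉ , u , u∈ , wu) =
      ⊥-elim (<-irrefl refl (≤-trans (length≤n (discovery-unique (discover w∉ u∈ wu D))) fuel))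
    grow (suc k) {xs} D fuel | yes (w , w∉ , u , u∈ , wu) =
      grow k (discover w∉ u∈ wu D) (subst (n G ≤_) (sym (+-suc k (length xs))) fuel)

  abstract
    searchOrder : Connected G → SearchOrder G r v
    searchOrder conn with discover-all conn
    ... | xs , D , all∈ = record
      { τ = rank xs
      ; τ-injective = rank-injective (all∈ _) (all∈ _)
      ; τ-bounded = λ w → <-≤-trans (rank<length (all∈ w)) (length≤n (discovery-unique D))
      ; τ-root = rank-root D
      ; τ-second = rank-second D
      ; descent = λ w ne → let u , _ , wu , lt = rank-descent D (all∈ w) ne in u , wu , lt
      }

to-injective : ∀ {A B : Set} (φ : A ↔ B) {x y : A} → Inverse.to φ x ≡ Inverse.to φ y → x ≡ y
to-injective φ {x} {y} e = trans (sym (Inverse.strictlyInverseʳ φ x))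
  (trans (cong (Inverse.from φ) e) (Inverse.strictlyInverseʳ φ y))

-- Parents, siblings and the auxiliary graph

module Search (G : Graph) {r v : Fin (n G)} (rv : Edge G r v) (O : SearchOrder G r v) where

  open SearchOrder O
  open Removal (_≟_ {n G})

  private
    V = Fin (n G)
    Δ = maxDegree G

  v≢r : v ≢ r
  v≢r = ≢-sym (edge-irrefl G rv)

  neighbour : ∀ w → ∃ (Edge G w)
  neighbour w with w ≟ r
  ... | yes refl = v , rv
  ... | no ne = let u , wu , _ = descent w ne in u , wu

  abstract
    parent : V → V
    parent w = proj₁ (minimiser (edge? G w) τ (neighbour w))

    parent-edge : ∀ w → Edge G w (parent w)
    parent-edge w = proj₁ (proj₂ (minimiser (edge? G w) τ (neighbour w)))

    parent-minimal : ∀ {w u} → Edge G w u → τ (parent w) ≤ τ u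
    parent-minimal {w} {u} = proj₂ (proj₂ (minimiser (edge? G w) τ (neighbour w))) u

  parent-< : ∀ {w} → w ≢ r → τ (parent w) < τ w
  parent-< {w} ne = let u , wu , lt = descent w ne in ≤-<-trans (parent-minimal wu) lt

  parent-root : ∀ {w} → Edge G r w → parent w ≡ r
  parent-root rw = τ-injective
    (trans (ℕₚ.n≤0⇒n≡0 (subst (τ (parent _) ≤_) τ-root (parent-minimal (edge-sym G rw)))) (sym τ-root))

  -- Only `r` precedes `v` in the order. In the absence of triangles this makes the neighbours of
  -- `v` other than `r` siblings, hence a clique of `H`.
  parent-second : ∀ {w} → Edge G v w → ¬ Edge G r w → parent w ≡ v
  parent-second {w} vw ¬rw with τ (parent w) in eq | subst (τ (parent w) ≤_) τ-second (parent-minimal (edge-sym G vw))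
  ... | zero | _ = ⊥-elim (¬rw (edge-sym G (subst (Edge G w) (τ-injective (trans eq (sym τ-root))) (parent-edge w))))
  ... | suc zero | _ = τ-injective (trans eq (sym τ-second))
  ... | suc (suc _) | s≤s ()

  τ≥2 : ∀ {w} → w ≢ r → w ≢ v → 2 ≤ τ w
  τ≥2 {w} ne ne′ with τ w in eq
  ... | 0 = ⊥-elim (ne (τ-injective (trans eq (sym τ-root))))
  ... | 1 = ⊥-elim (ne′ (τ-injective (trans eq (sym τ-second))))
  ... | suc (suc _) = s≤s (s≤s z≤n)

  child≢grandparent : ∀ {u} → u ≢ r → parent u ≢ r → u ≢ parent (parent u)
  child≢grandparent {u} u≢r p≢r e =
    <-irrefl refl (<-trans (parent-< p≢r) (subst (λ x → τ (parent u) < τ x) e (parent-< u≢r)))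

  -- A proper colouring of H extends to a distinguishing one as soon as the root is recognised.
  H : V → V → Set
  H u w = u ≢ r × w ≢ r × u ≢ w × (Edge G u w ⊎ parent u ≡ parent w)

  H? : ∀ u → Decidable (H u)
  H? u w = ¬? (u ≟ r) ×-dec ¬? (w ≟ r) ×-dec ¬? (u ≟ w) ×-dec (edge? G u w ⊎-dec (parent u ≟ parent w))

  H-sym : ∀ {u w} → H u w → H w u
  H-sym (a , b , c , inj₁ e) = b , a , ≢-sym c , inj₁ (edge-sym G e)
  H-sym (a , b , c , inj₂ e) = b , a , ≢-sym c , inj₂ (sym e)

  H-irrefl : ∀ {u w} → H u w → u ≢ w
  H-irrefl (_ , _ , c , _) = c

  H-parent : ∀ {w} → w ≢ r → parent w ≢ r → H w (parent w)
  H-parent w≢r p≢r = w≢r , p≢r , edge-irrefl G (parent-edge _) , inj₁ (parent-edge _)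

  degH : V → ℕ
  degH w = count (H? w)

  siblings : ∀ {p w} → H p w → parent p ≡ parent w → w ∈ nbrs G (parent p) ∖ p
  siblings {p} {w} (_ , _ , ne , _) e =
    ∈-∖⁺ (∈-nbrs⁺ G (subst (λ x → Edge G x w) (sym e) (edge-sym G (parent-edge w)))) (≢-sym ne)

  -- The root is not a vertex of `H`, so it is lost among the neighbours of `z`; and `z` is not its
  -- own sibling.
  degH-child : ∀ {z} → z ≢ r → parent z ≡ r → 2 + degH z ≤ length (nbrs G z) + length (nbrs G r)
  degH-child {z} z≢r pz = ≤-trans (s≤s (s≤s (count≤length (H? z) B cover))) bound
    where
    B = nbrs G z ∖ r ++ nbrs G r ∖ z
    cover : ∀ {u} → H z u → u ∈ B
    cover (_ , u≢r , _ , inj₁ zu) = ∈-++⁺ˡ (∈-∖⁺ (∈-nbrs⁺ G zu) u≢r)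
    cover h@(_ , _ , _ , inj₂ e) = ∈-++⁺ʳ (nbrs G z ∖ r) (subst (λ x → _ ∈ nbrs G x ∖ z) pz (siblings h e))
    zr : Edge G z r
    zr = subst (Edge G z) pz (parent-edge z)
    bound : 2 + length B ≤ length (nbrs G z) + length (nbrs G r)
    bound = subst (_≤ length (nbrs G z) + length (nbrs G r))
      (trans (cong suc (+-suc _ _)) (cong (2 +_) (sym (length-++ (nbrs G z ∖ r)))))
      (ℕₚ.+-mono-≤ (length-∖ (∈-nbrs⁺ G zr)) (length-∖ (∈-nbrs⁺ G (edge-sym G zr))))

  -- Among the neighbours of the parent, neither `z` nor the grandparent is a sibling of `z`: the
  -- grandparent comes before the parent, its children come after it.
  degH-inner : ∀ {z} → z ≢ r → parent z ≢ r → 2 + degH z ≤ length (nbrs G z) + length (nbrs G (parent z))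
  degH-inner {z} z≢r p≢r = ≤-trans (s≤s (s≤s (count≤length (H? z) B cover))) bound
    where
    p = parent z
    B = nbrs G z ++ nbrs G p ∖ z ∖ parent p
    cover : ∀ {u} → H z u → u ∈ B
    cover (_ , _ , _ , inj₁ zu) = ∈-++⁺ˡ (∈-nbrs⁺ G zu)
    cover {u} h@(_ , u≢r , _ , inj₂ e) = ∈-++⁺ʳ (nbrs G z) (∈-∖⁺ (siblings h e)
      (subst (λ x → u ≢ parent x) (sym e) (child≢grandparent u≢r (subst (_≢ r) e p≢r))))
    bound : 2 + length B ≤ length (nbrs G z) + length (nbrs G p)
    bound = subst (_≤ length (nbrs G z) + length (nbrs G p))
      (trans (+-suc _ _) (trans (cong suc (+-suc _ _)) (cong (2 +_) (sym (length-++ (nbrs G z))))))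
      (ℕₚ.+-monoʳ-≤ (length (nbrs G z))
        (≤-trans (s≤s (length-∖ (∈-∖⁺ (∈-nbrs⁺ G (parent-edge p)) (≢-sym (child≢grandparent z≢r p≢r)))))
          (length-∖ (∈-nbrs⁺ G (edge-sym G (parent-edge z))))))

  degH≤ : ∀ {z} → z ≢ r → 2 + degH z ≤ Δ + Δ
  degH≤ {z} z≢r with parent z ≟ r
  ... | yes pz = ≤-trans (degH-child z≢r pz) (ℕₚ.+-mono-≤ (length-nbrs≤ G z) (length-nbrs≤ G r))
  ... | no p≢r = ≤-trans (degH-inner z≢r p≢r) (ℕₚ.+-mono-≤ (length-nbrs≤ G z) (length-nbrs≤ G (parent z)))

  degH-second : 2 + degH v ≤ length (nbrs G v) + length (nbrs G r)
  degH-second = degH-child v≢r (parent-root rv)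

  -- A common neighbour of `r` and `v` is both a neighbour and a sibling of `v`, and is counted only
  -- once.
  degH-triangle : ∀ {w} → Edge G r w → Edge G v w → 3 + degH v ≤ length (nbrs G v) + length (nbrs G r)
  degH-triangle {w} rw vw = ≤-trans (s≤s (s≤s (s≤s (count≤length (H? v) B cover)))) bound
    where
    B = nbrs G v ∖ r ++ nbrs G r ∖ v ∖ w
    cover : ∀ {u} → H v u → u ∈ B
    cover (_ , u≢r , _ , inj₁ vu) = ∈-++⁺ˡ (∈-∖⁺ (∈-nbrs⁺ G vu) u≢r)
    cover {u} h@(_ , u≢r , v≢u , inj₂ e) with u ≟ w
    ... | yes refl = ∈-++⁺ˡ (∈-∖⁺ (∈-nbrs⁺ G vw) u≢r)
    ... | no u≢w = ∈-++⁺ʳ (nbrs G v ∖ r)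
      (∈-∖⁺ (subst (λ x → u ∈ nbrs G x ∖ v) (parent-root rv) (siblings h e)) u≢w)
    bound : 3 + length B ≤ length (nbrs G v) + length (nbrs G r)
    bound = subst (_≤ length (nbrs G v) + length (nbrs G r))
      (trans (cong suc (trans (+-suc _ _) (cong suc (+-suc _ _)))) (cong (3 +_) (sym (length-++ (nbrs G v ∖ r)))))
      (ℕₚ.+-mono-≤ (length-∖ (∈-nbrs⁺ G (edge-sym G rv)))
        (≤-trans (s≤s (length-∖ (∈-∖⁺ (∈-nbrs⁺ G rw) (≢-sym (edge-irrefl G vw)))))
          (length-∖ (∈-nbrs⁺ G rv))))

  -- Colouring against the search order

  module Greedy (Ls : V → List ℕ) (unique : ∀ w → Unique (Ls w)) where

    ProperFrom : ℕ → (V → ℕ) → Set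
    ProperFrom t g = (∀ {u w} → t ≤ τ u → t ≤ τ w → H u w → g u ≢ g w)
      × (∀ {u} → u ≢ r → t ≤ τ u → g u ∈ Ls u)

    colour-next : ∀ {t g} w → τ w ≡ t → count (λ u → H? w u ×-dec (t <? τ u)) < length (Ls w) →
      ProperFrom (suc t) g → ∃ (ProperFrom t)
    colour-next {t} {g} w τw room (proper , mem) = g′ , proper′ , mem′
      where
      later? : Decidable (λ u → H w u × t < τ u)
      later? u = H? w u ×-dec (t <? τ u)
      used = map g (filter later? (allFin (n G)))
      free = Removal.free-element ℕₚ._≟_ (unique w) used
        (subst (_< length (Ls w)) (sym (length-map g (filter later? (allFin (n G))))) room)
      c = proj₁ free
      g′ = g [ w ≔ c ]
      later : ∀ {u} → u ≢ w → t ≤ τ u → t < τ u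
      later ne le = ℕₚ.≤∧≢⇒< le (λ e → ne (τ-injective (trans (sym e) (sym τw))))
      proper-at : ∀ {u} → t ≤ τ u → H w u → g′ w ≢ g′ u
      proper-at {u} le h e = proj₂ (proj₂ free) (subst (_∈ used)
        (trans (sym (update-off g w (≢-sym (H-irrefl h)))) (trans (sym e) (update-at g w)))
        (∈-map⁺ g (∈-filter⁺ later? (∈-allFin u) (h , later (≢-sym (H-irrefl h)) le))))
      proper′ : ∀ {u u′} → t ≤ τ u → t ≤ τ u′ → H u u′ → g′ u ≢ g′ u′
      proper′ {u} {u′} le le′ h = by-cases (u ≟ w) (u′ ≟ w)
        where
        by-cases : Dec (u ≡ w) → Dec (u′ ≡ w) → g′ u ≢ g′ u′
        by-cases (yes refl) _ = proper-at le′ h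
        by-cases (no _) (yes refl) = ≢-sym (proper-at le (H-sym h))
        by-cases (no ne) (no ne′) e =
          proper (later ne le) (later ne′ le′) h (trans (sym (update-off g w ne)) (trans e (update-off g w ne′)))
      mem′ : ∀ {u} → u ≢ r → t ≤ τ u → g′ u ∈ Ls u
      mem′ {u} u≢r le = by-cases (u ≟ w)
        where
        by-cases : Dec (u ≡ w) → g′ u ∈ Ls u
        by-cases (yes refl) = subst (_∈ Ls w) (sym (update-at g w)) (proj₁ (proj₂ free))
        by-cases (no ne) = subst (_∈ Ls u) (sym (update-off g w ne)) (mem u≢r (later ne le))

    module _ (large : ∀ w → w ≢ r → Δ + Δ ≤ 2 + length (Ls w)) where

      -- The parent serves unless it is `r`, which is outside `H`; then `v` is an earlier sibling.
      -- This neighbour is still uncoloured when the turn of `w` comes, which saves one colour.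
      earlier-neighbour : ∀ {w} → w ≢ r → w ≢ v → ∃ λ u → H w u × τ u < τ w
      earlier-neighbour {w} w≢r w≢v with parent w ≟ r
      ... | no p≢r = parent w , H-parent w≢r p≢r , parent-< w≢r
      ... | yes pw = v , (w≢r , v≢r , w≢v , inj₂ (trans pw (sym (parent-root rv)))) ,
        subst (_< τ w) (sym τ-second) (τ≥2 w≢r w≢v)

      room : ∀ {w} → w ≢ r → w ≢ v → count (λ u → H? w u ×-dec (τ w <? τ u)) < length (Ls w)
      room {w} w≢r w≢v with earlier-neighbour w≢r w≢v
      ... | u₀ , wu₀ , lt = ℕₚ.≤-pred (ℕₚ.≤-pred (≤-trans (s≤s (s≤s less)) (≤-trans (degH≤ w≢r) (large w w≢r))))
        where
        cover : ∀ {u} → H w u × τ w < τ u → u ∈ filter (H? w) (allFin (n G)) ∖ u₀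
        cover (h , lt′) = ∈-∖⁺ (∈-filter⁺ (H? w) (∈-allFin _) h) (λ { refl → ℕₚ.<-asym lt lt′ })
        less : count (λ u → H? w u ×-dec (τ w <? τ u)) < degH w
        less = ≤-trans (s≤s (count≤length (λ u → H? w u ×-dec (τ w <? τ u)) _ cover))
          (length-∖ (∈-filter⁺ (H? w) (∈-allFin u₀) wu₀))

      greedy : ∃ (ProperFrom 2)
      greedy = go (n G) 2 refl ≤-refl
        where
        go : ∀ k t → k + t ≡ n G + 2 → 2 ≤ t → ∃ (ProperFrom t)
        -- No vertex has a position as large as `n G + 2`, so the constant 0 is a vacuous start.
        go zero t refl _ = (λ _ → 0) , (λ le → ⊥-elim (absurd le)) , λ _ le → ⊥-elim (absurd le)
          where
          absurd : ∀ {u} → ¬ (n G + 2 ≤ τ u)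
          absurd le = <-irrefl refl (<-≤-trans (τ-bounded _) (≤-trans (ℕₚ.m≤m+n (n G) 2) le))
        go (suc k) t e 2≤t with go k (suc t) (trans (+-suc k t) e) (ℕₚ.m≤n⇒m≤1+n 2≤t) | any? (λ w → τ w ℕₚ.≟ t)
        ... | g , p | yes (w , refl) = colour-next w refl (room w≢r w≢v) p
          where
          w≢r : w ≢ r
          w≢r refl = ℕₚ.<⇒≱ (s≤s z≤n) (subst (2 ≤_) τ-root 2≤t)
          w≢v : w ≢ v
          w≢v refl = ℕₚ.<⇒≱ (s≤s (s≤s z≤n)) (subst (2 ≤_) τ-second 2≤t)
        -- No vertex has position `t`, as happens for `t ≥ n G`; there is nothing to colour.
        ... | g , (proper , mem) | no ¬∃ = g , (λ le le′ → proper (up le) (up le′)) , λ u≢r le → mem u≢r (up le)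
          where
          up : ∀ {u} → t ≤ τ u → suc t ≤ τ u
          up {u} le = ℕₚ.≤∧≢⇒< le (λ e → ¬∃ (u , sym e))

      complete : degH v < length (Ls v) → ∃ (ProperFrom 1)
      complete lt = colour-next v τ-second
        (≤-<-trans (count-mono (λ u → H? v u ×-dec (1 <? τ u)) (H? v) proj₁) lt) (proj₂ greedy)

  -- Automorphisms and the search tree

  module _ (φ : V ↔ V) (aut : Automorphism G φ) where

    open Inverse φ using (to)

    -- Induction on the position of the parent `p` of `w`, which is fixed already. So `to w` is
    -- adjacent to `p` and its parent comes no later than `p`. If it comes earlier, the induction
    -- applies to `to w` itself, and injectivity gives `to w ≡ w`; otherwise the parents agree and
    -- `sib` applies.
    fixes-all : to r ≡ r → (∀ w → w ≢ r → to w ≢ r → parent (to w) ≡ parent w → to w ≡ w) → ∀ w → to w ≡ w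
    fixes-all root sib w = go w (<-wellFounded (τ (parent w)))
      where
      go : ∀ w → Acc _<_ (τ (parent w)) → to w ≡ w
      go w (acc rs) with w ≟ r
      ... | yes refl = root
      ... | no w≢r = by-cases (ℕₚ.m≤n⇒m<n∨m≡n (parent-minimal image-edge))
        where
        p = parent w
        fix-parent : to p ≡ p
        fix-parent with p ≟ r
        ... | yes e = subst (λ x → to x ≡ x) (sym e) root
        ... | no p≢r = go p (rs (parent-< p≢r))
        image-edge : Edge G (to w) p
        image-edge = subst (Edge G (to w)) fix-parent (trans (sym (aut w p)) (parent-edge w))
        by-cases : τ (parent (to w)) < τ p ⊎ τ (parent (to w)) ≡ τ p → to w ≡ w
        by-cases (inj₁ lt) = to-injective φ (go (to w) (rs lt))
        by-cases (inj₂ e) = sib w w≢r (λ e′ → w≢r (to-injective φ (trans e′ (sym root)))) (τ-injective e)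

-- Sliding the uncoloured vertex

module Sliding {N : ℕ} {H : Fin N → Fin N → Set} (H? : (u : Fin N) → Decidable (H u))
  (H-sym : {u w : Fin N} → H u w → H w u) (H-irrefl : {u w : Fin N} → H u w → u ≢ w)
  (C : List ℕ) (C-unique : Unique C) (degree≤ : (z : Fin N) → count {N} {H z} (H? z) ≤ length C)
  (uncolourable : (g : Fin N → ℕ) → (∀ {u w} → H u w → g u ≢ g w) → ¬ (∀ u → g u ∈ C))
  where

  private
    V = Fin N

  open Removal (_≟_ {N})

  -- The value `g z` is arbitrary, so the hole needs no colour of its own.
  Holed : V → (V → ℕ) → Set
  Holed z g = (∀ {u w} → u ≢ z → w ≢ z → H u w → g u ≢ g w) × (∀ {u} → u ≢ z → g u ∈ C)

  -- A colour missing around the hole could be put there, contrary to `uncolourable`.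
  saturated : ∀ {z g} → Holed z g → ∀ {c} → c ∈ C → ∃ λ u → H z u × g u ≡ c
  saturated {z} {g} (proper , mem) {c} c∈ with any? (λ u → H? z u ×-dec (g u ℕₚ.≟ c))
  ... | yes found = found
  ... | no ¬∃ = ⊥-elim (uncolourable g′ proper′ mem′)
    where
    g′ = g [ z ≔ c ]
    at-hole : ∀ {u} → H z u → g′ z ≢ g′ u
    at-hole {u} h e = ¬∃ (u , h ,
      trans (sym (update-off g z (≢-sym (H-irrefl h)))) (trans (sym e) (update-at g z)))
    proper′ : ∀ {u w} → H u w → g′ u ≢ g′ w
    proper′ {u} {w} h = by-cases (u ≟ z) (w ≟ z)
      where
      by-cases : Dec (u ≡ z) → Dec (w ≡ z) → g′ u ≢ g′ w
      by-cases (yes refl) _ = at-hole h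
      by-cases (no _) (yes refl) = ≢-sym (at-hole (H-sym h))
      by-cases (no ne) (no ne′) e =
        proper ne ne′ h (trans (sym (update-off g z ne)) (trans e (update-off g z ne′)))
    mem′ : ∀ u → g′ u ∈ C
    mem′ u = by-cases (u ≟ z)
      where
      by-cases : Dec (u ≡ z) → g′ u ∈ C
      by-cases (yes refl) = subst (_∈ C) (sym (update-at g z)) c∈
      by-cases (no ne) = subst (_∈ C) (sym (update-off g z ne)) (mem ne)

  -- All of `C` occurs around the hole, and `degree≤` leaves no neighbour over for a repetition.
  rainbow : ∀ {z g} → Holed z g → ∀ {u w} → H z u → H z w → g u ≡ g w → u ≡ w
  rainbow {z} {g} S {u} {w} zu zw e with u ≟ w
  ... | yes p = p
  ... | no u≢w = ⊥-elim (<-irrefl refl (<-≤-trans (length-∖ (nbr zu)) (≤-trans (degree≤ z)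
      (subst (length C ≤_) (length-map g (nbrsH ∖ u)) (length-unique-⊆ C-unique cover)))))
    where
    nbrsH = filter (H? z) (allFin N)
    nbr : ∀ {x} → H z x → x ∈ nbrsH
    nbr h = ∈-filter⁺ (H? z) (∈-allFin _) h
    cover : ∀ {c} → c ∈ C → c ∈ map g (nbrsH ∖ u)
    cover {c} c∈ with saturated S c∈
    ... | x , zx , refl with x ≟ u
    ...   | no ne = ∈-map⁺ g (∈-∖⁺ (nbr zx) ne)
    ...   | yes refl = subst (_∈ map g (nbrsH ∖ u)) (sym e) (∈-map⁺ g (∈-∖⁺ (nbr zw) (≢-sym u≢w)))

  -- By `rainbow`, no neighbour of `z` other than `y` has the colour of `y`, so this colour can be
  -- moved to `z`.
  slide : ∀ {z y g} → Holed z g → H z y → Holed y (g [ z ≔ g y ])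
  slide {z} {y} {g} S@(proper , mem) zy = proper′ , mem′
    where
    g′ = g [ z ≔ g y ]
    at-old : ∀ {u} → u ≢ y → H z u → g′ z ≢ g′ u
    at-old ne zu e = ne (rainbow S zu zy
      (trans (sym (update-off g z (≢-sym (H-irrefl zu)))) (trans (sym e) (update-at g z))))
    proper′ : ∀ {u w} → u ≢ y → w ≢ y → H u w → g′ u ≢ g′ w
    proper′ {u} {w} u≢y w≢y h = by-cases (u ≟ z) (w ≟ z)
      where
      by-cases : Dec (u ≡ z) → Dec (w ≡ z) → g′ u ≢ g′ w
      by-cases (yes refl) _ = at-old w≢y h
      by-cases (no _) (yes refl) = ≢-sym (at-old u≢y (H-sym h))
      by-cases (no ne) (no ne′) e =
        proper ne ne′ h (trans (sym (update-off g z ne)) (trans e (update-off g z ne′)))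
    mem′ : ∀ {u} → u ≢ y → g′ u ∈ C
    mem′ {u} u≢y = by-cases (u ≟ z)
      where
      by-cases : Dec (u ≡ z) → g′ u ∈ C
      by-cases (yes refl) = subst (_∈ C) (sym (update-at g z)) (mem (≢-sym (H-irrefl zy)))
      by-cases (no ne) = subst (_∈ C) (sym (update-off g z ne)) (mem ne)

  -- Carrying the hole once round the 4-cycle turns the colours of c₁, c₂, c₃ into those of c₂, c₃, c₁.
  4-cycle-chord : ∀ {z c₁ c₂ c₃ g} → Holed z g → H z c₁ → H c₁ c₂ → H c₂ c₃ → H c₃ z →
    c₁ ≢ c₃ → z ≢ c₂ → ¬ ¬ H z c₂
  4-cycle-chord {z} {c₁} {c₂} {c₃} {g} S zc₁ c₁c₂ c₂c₃ c₃z c₁≢c₃ z≢c₂ ¬zc₂ = around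
    where
    c₁≢z = ≢-sym (H-irrefl zc₁)
    c₃≢z = H-irrefl c₃z
    c₂≢z = ≢-sym z≢c₂
    c₁≢c₂ = H-irrefl c₁c₂
    c₃≢c₂ = ≢-sym (H-irrefl c₂c₃)
    g₁ = g [ z ≔ g c₁ ]
    g₂ = g₁ [ c₁ ≔ g₁ c₂ ]
    g₃ = g₂ [ c₂ ≔ g₂ c₃ ]
    g₄ = g₃ [ c₃ ≔ g₃ z ]
    S₄ : Holed z g₄
    S₄ = slide (slide (slide (slide S zc₁) c₁c₂) c₂c₃) c₃z
    g₃z : g₃ z ≡ g c₁
    g₃z = trans (update-off g₂ c₂ z≢c₂) (trans (update-off g₁ c₁ (≢-sym c₁≢z)) (update-at g z))
    g₄c₁ : g₄ c₁ ≡ g c₂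
    g₄c₁ = trans (update-off g₃ c₃ c₁≢c₃) (trans (update-off g₂ c₂ c₁≢c₂)
      (trans (update-at g₁ c₁) (update-off g z c₂≢z)))
    g₄-off : ∀ {u} → u ≢ z → u ≢ c₁ → u ≢ c₂ → u ≢ c₃ → g₄ u ≡ g u
    g₄-off u≢z u≢c₁ u≢c₂ u≢c₃ = trans (update-off g₃ c₃ u≢c₃) (trans (update-off g₂ c₂ u≢c₂)
      (trans (update-off g₁ c₁ u≢c₁) (update-off g z u≢z)))
    absurd : ∀ {u} → H z u → g₄ u ≡ g c₃ → Dec (u ≡ c₁) → Dec (u ≡ c₂) → Dec (u ≡ c₃) → ⊥
    absurd zu e _ _ (yes refl) =
      c₁≢c₃ (rainbow S zc₁ (H-sym c₃z) (trans (sym g₃z) (trans (sym (update-at g₃ c₃)) e)))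
    absurd zu e _ (yes refl) (no _) = ¬zc₂ zu
    absurd zu e (yes refl) (no _) (no _) = proj₁ S c₂≢z c₃≢z c₂c₃ (trans (sym g₄c₁) e)
    absurd zu e (no ne₁) (no ne₂) (no ne₃) =
      ne₃ (rainbow S zu (H-sym c₃z) (trans (sym (g₄-off (≢-sym (H-irrefl zu)) ne₁ ne₂ ne₃)) e))
    around : ⊥
    -- The old colour of `c₃` must occur around `z` again. It now sits at `c₂`, which is no
    -- neighbour of `z`, and every other place is excluded.
    around = let u , zu , e = saturated S₄ (proj₂ S c₃≢z) in
      absurd zu e (u ≟ c₁) (u ≟ c₂) (u ≟ c₃)

  -- Moving the hole along paths

  data Path (y : V) : V → Set where
    []  : Path y y
    _∷_ : ∀ {w w′} → H w w′ → Path y w′ → Path y w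

  vertices : ∀ {y w} → Path y w → List V
  vertices {w = w} [] = w ∷ []
  vertices {w = w} (_ ∷ p) = w ∷ vertices p

  start-∈ : ∀ {y w} (p : Path y w) → w ∈ vertices p
  start-∈ [] = here refl
  start-∈ (_ ∷ _) = here refl

  end-∈ : ∀ {y w} (p : Path y w) → y ∈ vertices p
  end-∈ [] = here refl
  end-∈ (_ ∷ p) = there (end-∈ p)

  suffix : ∀ {y w u} (p : Path y w) → Unique (vertices p) → u ∈ vertices p →
    Σ (Path y u) λ q → Unique (vertices q) × (∀ {x} → x ∈ vertices q → x ∈ vertices p)
  suffix [] uniq (here refl) = [] , uniq , id
  suffix p@(_ ∷ _) uniq (here refl) = p , uniq , id
  suffix (_ ∷ p) (_ ∷ uniq) (there u∈) with suffix p uniq u∈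
  ... | q , uniq′ , sub = q , uniq′ , there ∘ sub

  -- Each vertex takes over the colour of its successor as the hole passes. The path is simple, so
  -- no vertex is passed twice and `w` keeps what it received.
  slide-along : ∀ {w w′ y g} → Holed w g → H w w′ → (p : Path y w′) → Unique (w ∷ vertices p) →
    ∃ λ g′ → Holed y g′ × g′ w ≡ g w′ × (∀ {u} → u ∉ w ∷ vertices p → g′ u ≡ g u)
  slide-along {w} {g = g} S ww′ [] _ =
    _ , slide S ww′ , update-at g w , λ u∉ → update-off g w (λ e → u∉ (here e))
  slide-along {w} {g = g} S ww′ (h ∷ p) (w∉ ∷ uniq) with slide-along (slide S ww′) h p uniq
  ... | g′ , S′ , _ , off = g′ , S′ ,
    trans (off (λ w∈ → All-lookup w∉ w∈ refl)) (update-at g w) ,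
    λ u∉ → trans (off (u∉ ∘ there)) (update-off g w (λ e → u∉ (here e)))

  -- The hole travels v, x, c, …, y, v.  Only x and y among the neighbours of v change colour,
  -- and y receives the colour of x.
  rotate : ∀ {v x c y g} → Holed v g → H v x → H x c → (p : Path y c) → H v y →
    Unique (x ∷ vertices p) → v ∉ x ∷ vertices p → (∀ {u} → u ∈ vertices p → H v u → u ≡ y) →
    g c ≡ g y
  rotate {v} {x} {c} {y} {g} S vx xc p vy uniq v∉ only-y
    with slide-along (slide S vx) xc p uniq
  ... | g₂ , S₂ , g₂x , off = conclude
    where
    x≢y : x ≢ y
    x≢y refl = Unique[x∷xs]⇒x∉xs uniq (end-∈ p)
    v≢y = H-irrefl vy
    g₃ = g₂ [ y ≔ g₂ v ]
    g₂v : g₂ v ≡ g x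
    g₂v = trans (off v∉) (update-at g v)
    by-cases : ∀ {u} → H v u → g₃ u ≡ g y → Dec (u ≡ x) → Dec (u ≡ y) → g c ≡ g y
    by-cases vu e _ (yes refl) =
      ⊥-elim (x≢y (rainbow S vx vy (trans (sym g₂v) (trans (sym (update-at g₂ y)) e))))
    by-cases vu e (yes refl) (no u≢y) =
      trans (trans (sym (update-off g v (λ { refl → v∉ (there (start-∈ p)) }))) (sym g₂x))
        (trans (sym (update-off g₂ y u≢y)) e)
    by-cases {u} vu e (no u≢x) (no u≢y) = ⊥-elim (u≢y (rainbow S vu vy (trans
      (sym (trans (update-off g₂ y u≢y) (trans (off u∉) (update-off g v (≢-sym (H-irrefl vu)))))) e)))
      where
      u∉ : u ∉ x ∷ vertices p
      u∉ (here e) = u≢x e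
      u∉ (there u∈) = u≢y (only-y u∈ vu)
    conclude : g c ≡ g y
    -- The old colour of `y` must occur around `v`. Now `y` has the colour of `x`, and the unchanged
    -- neighbours are excluded by `rainbow`; so it occurs at `x`, which received the colour of `c`.
    conclude = let u , vu , e = saturated (slide S₂ (H-sym vy)) (proj₂ S (≢-sym v≢y)) in
      by-cases vu e (u ≟ x) (u ≟ y)

  -- The hole goes once around the triangle, and the colours of `y` and `y′` change places.
  swap-triangle : ∀ {v y y′ g} → Holed v g → H v y → H y y′ → H v y′ →
    ∃ λ g′ → Holed v g′ × g′ y ≡ g y′ × (∀ {u} → u ≢ v → u ≢ y → u ≢ y′ → g′ u ≡ g u)
  swap-triangle {v} {y} {y′} {g} S vy yy′ vy′ = g₃ , slide (slide (slide S vy) yy′) (H-sym vy′) ,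
    trans (update-off g₂ y′ (H-irrefl yy′)) (trans (update-at g₁ y) (update-off g v (≢-sym (H-irrefl vy′)))) ,
    λ u≢v u≢y u≢y′ → trans (update-off g₂ y′ u≢y′) (trans (update-off g₁ y u≢y) (update-off g v u≢v))
    where
    g₁ = g [ v ≔ g y ]
    g₂ = g₁ [ y ≔ g₁ y′ ]
    g₃ = g₂ [ y′ ≔ g₂ v ]

  -- A hole whose neighbourhood splits into two cliques

  module TwoCliques {v : V} {X Y : V → Set} (X? : Decidable X) (Y? : Decidable Y)
    (split : ∀ {u} → H v u → X u ⊎ Y u) (vX : ∀ {u} → X u → H v u) (vY : ∀ {u} → Y u → H v u)
    (disjoint : ∀ {u} → X u → ¬ Y u)
    (X-clique : ∀ {u w} → X u → X w → u ≢ w → H u w) (Y-clique : ∀ {u w} → Y u → Y w → u ≢ w → H u w)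
    (Y-other : ∀ {y} → Y y → ∃ λ y′ → Y y′ × y ≢ y′)
    {g₀ : V → ℕ} (S₀ : Holed v g₀) {x₀ y₀ : V} (Xx₀ : X x₀) (Yy₀ : Y y₀) (x₀≁y₀ : ¬ H x₀ y₀)
    where

    X≢Y : ∀ {x y} → X x → Y y → x ≢ y
    X≢Y Xx Yy refl = disjoint Xx Yy

    -- With the hole at `x₀`, the 4-cycle `x₀`, `v`, `y₀`, `y` would lack the chord from `x₀` to
    -- `y₀`.
    x₀≁Y : ∀ {y} → Y y → ¬ H x₀ y
    x₀≁Y {y} Yy h = 4-cycle-chord (slide S₀ (vX Xx₀)) (H-sym (vX Xx₀)) (vY Yy₀)
      (Y-clique Yy₀ Yy (λ { refl → x₀≁y₀ h })) (H-sym h) (H-irrefl (vY Yy)) (X≢Y Xx₀ Yy₀) x₀≁y₀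

    -- With the hole at `y`, the 4-cycle `y`, `x`, `x₀`, `v` would lack the chord from `y` to `x₀`.
    X≁Y : ∀ {x y} → X x → Y y → ¬ H x y
    X≁Y {x} {y} Xx Yy h = 4-cycle-chord (slide S₀ (vY Yy)) (H-sym h)
      (X-clique Xx Xx₀ (λ { refl → x₀≁Y Yy h })) (H-sym (vX Xx₀)) (vY Yy)
      (≢-sym (H-irrefl (vX Xx))) (≢-sym (X≢Y Xx₀ Yy)) (x₀≁Y Yy ∘ H-sym)

    -- The component of `y₀` in `H` without `v`.
    data Reach : V → Set where
      start : Reach y₀
      step  : ∀ {w w′} → Reach w → H w w′ → w′ ≢ v → Reach w′

    record Approach (w : V) : Set where
      field
        {end}  : V
        Y-end  : Y end
        path   : Path end w
        unique : Unique (vertices path)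
        avoids : v ∉ vertices path
        only   : ∀ {u} → u ∈ vertices path → H v u → u ≡ end

    -- A route for the hole in `rotate`: out through `x`, along the path, and back through its end
    -- in `Y`.
    record Crossing : Set where
      field
        {x c}    : V
        Xx       : X x
        xc       : H x c
        approach : Approach c

    trivial : ∀ {y} → Y y → Approach y
    trivial Yy = record { Y-end = Yy ; path = [] ; unique = [] ∷ [] ; avoids = λ { (here e) → H-irrefl (vY Yy) e }
      ; only = λ { (here e) _ → e } }

    -- The walk from `y₀` is followed until it enters `X`. The path back to `Y` is restarted at
    -- every vertex of `Y` and cut at every repetition, so it stays simple and meets the
    -- neighbourhood of `v` at most in its end.
    follow : ∀ {w} → Reach w → Crossing ⊎ Approach w
    follow start = inj₂ (trivial Yy₀)
    follow (step {w} {w′} ρ h w′≢v) with follow ρ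
    ... | inj₁ found = inj₁ found
    ... | inj₂ a with X? w′ | Y? w′ | DecMembership._∈?_ _≟_ w′ (vertices (Approach.path a))
    ...   | yes Xw′ | _ | _ = inj₁ (record { Xx = Xw′ ; xc = H-sym h ; approach = a })
    ...   | no _ | yes Yw′ | _ = inj₂ (trivial Yw′)
    ...   | no _ | no _ | yes w′∈ = let q , uniq , sub = suffix path unique w′∈ in
      inj₂ (record { Y-end = Y-end ; path = q ; unique = uniq ; avoids = avoids ∘ sub ; only = only ∘ sub })
      where open Approach a
    ...   | no ¬X | no ¬Y | no w′∉ = inj₂ (record
      { Y-end = Y-end ; path = H-sym h ∷ path
      ; unique = All-tabulate (λ { u∈ refl → w′∉ u∈ }) ∷ unique
      ; avoids = λ { (here e) → w′≢v (sym e) ; (there v∈) → avoids v∈ }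
      ; only = λ { (here refl) vu → ⊥-elim ([ ¬X , ¬Y ]′ (split vu)) ; (there u∈) vu → only u∈ vu } })
      where open Approach a

    -- By `rotate`, `c` has the colour of the end of the path in every colouring with hole `v`.
    -- Exchanging the colours of this end and another vertex of `Y` changes the former, but not the
    -- colour of `c`, which is outside `Y` by `X≁Y`.
    no-crossing : ¬ Crossing
    no-crossing cr with Y-other (Approach.Y-end (Crossing.approach cr))
    ... | y′ , Yy′ , y≢y′ with swap-triangle S₀ (vY (Approach.Y-end (Crossing.approach cr)))
            (Y-clique (Approach.Y-end (Crossing.approach cr)) Yy′ y≢y′) (vY Yy′)
    ...   | g′ , S′ , g′y , off = y≢y′ (rainbow S₀ vy (vY Yy′)
            (trans (sym (turn S₀)) (trans (sym (off c≢v (c≢Y Y-end) (c≢Y Yy′))) (trans (turn S′) g′y))))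
      where
      open Crossing cr
      open Approach approach
      vy = vY Y-end
      c≢v : c ≢ v
      c≢v refl = avoids (start-∈ path)
      c≢Y : ∀ {y} → Y y → c ≢ y
      c≢Y Yy refl = X≁Y Xx Yy xc
      x∉ : ∀ {u} → u ∈ vertices path → x ≢ u
      x∉ u∈ refl = X≢Y Xx Y-end (only u∈ (vX Xx))
      turn : ∀ {g} → Holed v g → g c ≡ g end
      turn S = rotate S (vX Xx) xc path vy (All-tabulate x∉ ∷ unique)
        (λ { (here e) → H-irrefl (vX Xx) e ; (there v∈) → avoids v∈ }) only

    -- Since x₀ and y₀ lie in different components of H − v, their colours can be exchanged in that of y₀ only.
    impossible : ⊥
    impossible = ¬¬-decidable {P = Reach} recolour
      where
      a = g₀ x₀
      b = g₀ y₀
      exchange : ℕ → ℕ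
      exchange c with c ℕₚ.≟ a | c ℕₚ.≟ b
      ... | yes _ | _ = b
      ... | no _ | yes _ = a
      ... | no _ | no _ = c
      exchange-b : exchange b ≡ a
      exchange-b with b ℕₚ.≟ a | b ℕₚ.≟ b
      ... | yes e | _ = e
      ... | no _ | yes _ = refl
      ... | no _ | no ne = ⊥-elim (ne refl)
      exchange-injective : ∀ {c d} → exchange c ≡ exchange d → c ≡ d
      exchange-injective {c} {d} e with c ℕₚ.≟ a | c ℕₚ.≟ b | d ℕₚ.≟ a | d ℕₚ.≟ b
      ... | yes p | _ | yes q | _ = trans p (sym q)
      ... | yes p | _ | no _ | yes q = trans p (trans (sym e) (sym q))
      ... | yes p | _ | no _ | no q = ⊥-elim (q (sym e))
      ... | no _ | yes p | yes q | _ = trans p (trans (sym e) (sym q))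
      ... | no _ | yes p | no _ | yes q = trans p (sym q)
      ... | no _ | yes p | no q | no _ = ⊥-elim (q (sym e))
      ... | no _ | no p | yes q | _ = ⊥-elim (p e)
      ... | no p | no _ | no _ | yes q = ⊥-elim (p e)
      ... | no _ | no _ | no _ | no _ = e
      exchange-∈ : ∀ {c} → c ∈ C → exchange c ∈ C
      exchange-∈ {c} c∈ with c ℕₚ.≟ a | c ℕₚ.≟ b
      ... | yes _ | _ = proj₂ S₀ (≢-sym (H-irrefl (vY Yy₀)))
      ... | no _ | yes _ = proj₂ S₀ (≢-sym (H-irrefl (vX Xx₀)))
      ... | no _ | no _ = c∈
      recolour : ¬ Decidable Reach
      -- Now `y₀` has the colour of `x₀`, which lies outside the component and keeps it. Both are
      -- neighbours of the hole, against `rainbow`.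
      recolour reach? = X≢Y Xx₀ Yy₀ (rainbow S′ (vX Xx₀) (vY Yy₀) (trans (g′-outside ¬reach-x₀) (sym g′y₀)))
        where
        g′ : V → ℕ
        g′ u with reach? u
        ... | yes _ = exchange (g₀ u)
        ... | no _ = g₀ u
        g′-inside : ∀ {u} → Reach u → g′ u ≡ exchange (g₀ u)
        g′-inside {u} ρ with reach? u
        ... | yes _ = refl
        ... | no ¬ρ = ⊥-elim (¬ρ ρ)
        g′-outside : ∀ {u} → ¬ Reach u → g′ u ≡ g₀ u
        g′-outside {u} ¬ρ with reach? u
        ... | yes ρ = ⊥-elim (¬ρ ρ)
        ... | no _ = refl
        g′y₀ : g′ y₀ ≡ a
        g′y₀ = trans (g′-inside start) exchange-b
        ¬reach-x₀ : ¬ Reach x₀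
        ¬reach-x₀ ρ with follow ρ
        ... | inj₁ found = no-crossing found
        ... | inj₂ ap = X≢Y Xx₀ (Approach.Y-end ap) (Approach.only ap (start-∈ (Approach.path ap)) (vX Xx₀))
        S′ : Holed v g′
        S′ = proper′ , mem′
          where
          proper′ : ∀ {u w} → u ≢ v → w ≢ v → H u w → g′ u ≢ g′ w
          proper′ {u} {w} u≢v w≢v h e = by-cases (reach? u) (reach? w)
            where
            by-cases : Dec (Reach u) → Dec (Reach w) → ⊥
            by-cases (yes ρ) (yes ρ′) = proj₁ S₀ u≢v w≢v h
              (exchange-injective (trans (sym (g′-inside ρ)) (trans e (g′-inside ρ′))))
            by-cases (yes ρ) (no ¬ρ) = ¬ρ (step ρ h w≢v)
            by-cases (no ¬ρ) (yes ρ) = ¬ρ (step ρ (H-sym h) u≢v)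
            by-cases (no ¬ρ) (no ¬ρ′) = proj₁ S₀ u≢v w≢v h
              (trans (sym (g′-outside ¬ρ)) (trans e (g′-outside ¬ρ′)))
          mem′ : ∀ {u} → u ≢ v → g′ u ∈ C
          mem′ {u} u≢v = by-cases (reach? u)
            where
            by-cases : Dec (Reach u) → g′ u ∈ C
            by-cases (yes ρ) = subst (_∈ C) (sym (g′-inside ρ)) (exchange-∈ (proj₂ S₀ u≢v))
            by-cases (no ¬ρ) = subst (_∈ C) (sym (g′-outside ¬ρ)) (proj₂ S₀ u≢v)

-- Recognising K_{m,m} and C₆

lookup-injective : {A : Set} {xs : List A} → Unique xs → {i j : Fin (length xs)} → lookup xs i ≡ lookup xs j → i ≡ j
lookup-injective {xs = _ ∷ _} _ {zero} {zero} _ = refl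
lookup-injective (x∉ ∷ _) {zero} {suc j} e = ⊥-elim (All-lookup x∉ (∈-lookup j) e)
lookup-injective (x∉ ∷ _) {suc i} {zero} e = ⊥-elim (All-lookup x∉ (∈-lookup i) (sym e))
lookup-injective (_ ∷ u) {suc i} {suc j} e = cong suc (lookup-injective u e)

enumerate : {A : Set} {xs : List A} {m : ℕ} → Unique xs → length xs ≡ m →
  Σ (Fin m → A) λ f → (∀ {i j} → f i ≡ f j → i ≡ j) × (∀ i → f i ∈ xs) × (∀ {x} → x ∈ xs → ∃ λ i → f i ≡ x)
enumerate {xs = xs} u refl = lookup xs , lookup-injective u , (λ i → ∈-lookup i) ,
  λ x∈ → index x∈ , sym (lookup-index x∈)

isomorphic-from : (G K : Graph) (c : Fin (n K) → Fin (n G)) → (∀ {i j} → c i ≡ c j → i ≡ j) →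
  (∀ w → ∃ λ i → c i ≡ w) → (∀ i j → adj G (c i) (c j) ≡ adj K i j) → Isomorphic G K
isomorphic-from G K c inj surj same = mk↔ₛ′ idx c (λ i → inj (proj₂ (surj (c i)))) (λ w → proj₂ (surj w)) ,
  λ u w → trans (cong₂ (adj G) (sym (proj₂ (surj u))) (sym (proj₂ (surj w)))) (same (idx u) (idx w))
  where
  idx : Fin (n G) → Fin (n K)
  idx w = proj₁ (surj w)

non-edge : (G : Graph) {u w : Fin (n G)} → ¬ Edge G u w → adj G u w ≡ false
non-edge G = Boolₚ.¬-not

left : ∀ m → Fin (m + m) → Bool
left m i = toℕ i <ᵇ m

left-↑ˡ : ∀ {m} (k : Fin m) → left m (k ↑ˡ m) ≡ true
left-↑ˡ {m} k with toℕ (k ↑ˡ m) <ᵇ m | ℕₚ.<⇒<ᵇ (subst (_< m) (sym (toℕ-↑ˡ k m)) (toℕ<n k))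
... | true | _ = refl

left-↑ʳ : ∀ {m} (k : Fin m) → left m (m ↑ʳ k) ≡ false
left-↑ʳ {m} k with toℕ (m ↑ʳ k) <ᵇ m | ℕₚ.<ᵇ⇒< (toℕ (m ↑ʳ k)) m
... | false | _ = refl
... | true | lt = contradiction (lt _) (ℕₚ.≤⇒≯ (subst (m ≤_) (sym (toℕ-↑ʳ m k)) (ℕₚ.m≤m+n m (toℕ k))))

Kmm-from : (G : Graph) {m : ℕ} (a b : Fin m → Fin (n G)) →
  (∀ {i j} → a i ≡ a j → i ≡ j) → (∀ {i j} → b i ≡ b j → i ≡ j) →
  (∀ i j → Edge G (a i) (b j)) → (∀ i j → ¬ Edge G (a i) (a j)) → (∀ i j → ¬ Edge G (b i) (b j)) →
  (∀ w → (∃ λ i → a i ≡ w) ⊎ (∃ λ i → b i ≡ w)) → Isomorphic G (Kmm m)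
Kmm-from G {m} a b a-inj b-inj ab aa bb surj = isomorphic-from G (Kmm m) c c-inj c-surj c-adj
  where
  s : Fin (m + m) → Fin m ⊎ Fin m
  s = splitAt m
  c : Fin (m + m) → Fin (n G)
  c i = [ a , b ]′ (s i)
  inj⊎ : ∀ x y → [ a , b ]′ x ≡ [ a , b ]′ y → x ≡ y
  inj⊎ (inj₁ i) (inj₁ j) e = cong inj₁ (a-inj e)
  inj⊎ (inj₁ i) (inj₂ j) e = ⊥-elim (edge-irrefl G (ab i j) e)
  inj⊎ (inj₂ i) (inj₁ j) e = ⊥-elim (edge-irrefl G (ab j i) (sym e))
  inj⊎ (inj₂ i) (inj₂ j) e = cong inj₂ (b-inj e)
  c-inj : ∀ {i j} → c i ≡ c j → i ≡ j
  c-inj {i} {j} e = trans (sym (join-splitAt m m i))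
    (trans (cong (join m m) (inj⊎ (s i) (s j) e)) (join-splitAt m m j))
  c-surj : ∀ w → ∃ λ i → c i ≡ w
  c-surj w with surj w
  ... | inj₁ (k , e) = k ↑ˡ m , trans (cong [ a , b ]′ (splitAt-↑ˡ m k m)) e
  ... | inj₂ (k , e) = m ↑ʳ k , trans (cong [ a , b ]′ (splitAt-↑ʳ m m k)) e
  -- Adjacency is compared on `Fin m ⊎ Fin m`, where the side is visible, and then carried over by
  -- `join-splitAt`.
  adj⊎ : ∀ x y → adj G ([ a , b ]′ x) ([ a , b ]′ y) ≡ left m (join m m x) xor left m (join m m y)
  adj⊎ (inj₁ i) (inj₁ j) rewrite left-↑ˡ i | left-↑ˡ j = non-edge G (aa i j)
  adj⊎ (inj₁ i) (inj₂ j) rewrite left-↑ˡ i | left-↑ʳ j = ab i j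
  adj⊎ (inj₂ i) (inj₁ j) rewrite left-↑ʳ i | left-↑ˡ j = edge-sym G (ab j i)
  adj⊎ (inj₂ i) (inj₂ j) rewrite left-↑ʳ i | left-↑ʳ j = non-edge G (bb i j)
  c-adj : ∀ i j → adj G (c i) (c j) ≡ left m i xor left m j
  c-adj i j = trans (adj⊎ (s i) (s j))
    (cong₂ (λ x y → left m x xor left m y) (join-splitAt m m i) (join-splitAt m m j))

-- Otherwise `w ∷ xs` would be a duplicate-free list of neighbours longer than the degree.
saturate-nbrs : (G : Graph) {p : Fin (n G)} {xs : List (Fin (n G))} → Unique xs → length (nbrs G p) ≤ length xs →
  (∀ {x} → x ∈ xs → Edge G p x) → ∀ {w} → Edge G p w → w ∈ xs
saturate-nbrs G {p} {xs} u le edges {w} pw with DecMembership._∈?_ (_≟_ {n G}) w xs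
... | yes w∈ = w∈
... | no w∉ = ⊥-elim (<-irrefl refl (≤-trans (length-unique-⊆ (All-tabulate (λ { x∈ refl → w∉ x∈ }) ∷ u) sub) le))
  where
  sub : ∀ {x} → x ∈ w ∷ xs → x ∈ nbrs G p
  sub (here refl) = ∈-nbrs⁺ G pw
  sub (there x∈) = ∈-nbrs⁺ G (edges x∈)

pattern i₀ = zero
pattern i₁ = suc zero
pattern i₂ = suc (suc zero)
pattern i₃ = suc (suc (suc zero))
pattern i₄ = suc (suc (suc (suc zero)))
pattern i₅ = suc (suc (suc (suc (suc zero))))

-- Five steps forward around the hexagon are one step back.
next prev : Fin 6 → Fin 6
next i = lookup (i₁ ∷ i₂ ∷ i₃ ∷ i₄ ∷ i₅ ∷ i₀ ∷ []) i
prev i = next (next (next (next (next i))))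

C6-edges : ∀ i j → (adj C6 i j ≡ true × (j ≡ next i ⊎ j ≡ prev i)) ⊎ (adj C6 i j ≡ false × j ≢ next i × j ≢ prev i)
C6-edges = from-yes (all? λ i → all? λ j →
  ((adj C6 i j Boolₚ.≟ true) ×-dec ((j ≟ next i) ⊎-dec (j ≟ prev i)))
  ⊎-dec ((adj C6 i j Boolₚ.≟ false) ×-dec ¬? (j ≟ next i) ×-dec ¬? (j ≟ prev i)))

next-prev : ∀ i → next (prev i) ≡ i × next i ≢ prev i
next-prev = from-yes (all? λ i → (next (prev i) ≟ i) ×-dec ¬? (next i ≟ prev i))

-- Each vertex of the cycle has its two neighbours on the cycle already, so there are no chords and
-- no edges leaving it; by connectedness it is all of `G`.
C6-from : (G : Graph) → Connected G → (∀ w → length (nbrs G w) ≤ 2) → (c : Fin 6 → Fin (n G)) →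
  (∀ {i j} → c i ≡ c j → i ≡ j) → (∀ i → Edge G (c i) (c (next i))) → Isomorphic G C6
C6-from G conn deg c inj edges = isomorphic-from G C6 c inj
  (λ w → reachable-ind G {P = λ u → ∃ λ i → c i ≡ u} extend (conn (c zero) w) (zero , refl)) same
  where
  back : ∀ i → Edge G (c i) (c (prev i))
  back i = edge-sym G (subst (λ x → Edge G (c (prev i)) (c x)) (proj₁ (next-prev i)) (edges (prev i)))
  around : ∀ i {w} → Edge G (c i) w → w ≡ c (next i) ⊎ w ≡ c (prev i)
  around i iw with saturate-nbrs G {xs = c (next i) ∷ c (prev i) ∷ []}
    (((λ e → proj₂ (next-prev i) (inj e)) ∷ []) ∷ [] ∷ []) (deg (c i))
    (λ { (here refl) → edges i ; (there (here refl)) → back i }) iw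
  ... | here e = inj₁ e
  ... | there (here e) = inj₂ e
  extend : ∀ {u w} → (∃ λ i → c i ≡ u) → Edge G u w → ∃ λ i → c i ≡ w
  extend (i , refl) uw with around i uw
  ... | inj₁ e = next i , sym e
  ... | inj₂ e = prev i , sym e
  same : ∀ i j → adj G (c i) (c j) ≡ adj C6 i j
  same i j with C6-edges i j
  ... | inj₁ (t , inj₁ refl) = trans (edges i) (sym t)
  ... | inj₁ (t , inj₂ refl) = trans (back i) (sym t)
  ... | inj₂ (f , ≢next , ≢prev) = trans (non-edge G ¬edge) (sym f)
    where
    ¬edge : ¬ Edge G (c i) (c j)
    ¬edge e with around i e
    ... | inj₁ p = ≢next (inj p)
    ... | inj₂ p = ≢prev (inj p)

-- The upper bound

module _ (G : Graph) {r v : Fin (n G)} (rv : Edge G r v) (O : SearchOrder G r v) where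

  open Search G rv O

  -- The colour of `r` occurs nowhere else, so `r` is fixed; siblings have different colours, so
  -- `fixes-all` applies.
  root-determines : ∀ f → (∀ {u w} → H u w → f u ≢ f w) → (∀ {u} → u ≢ r → f u ≢ f r) →
    Proper G f × Distinguishing G f
  root-determines f proper apart = proper′ , distinguishing
    where
    proper′ : Proper G f
    proper′ u w uw with u ≟ r | w ≟ r
    ... | yes refl | _ = ≢-sym (apart (≢-sym (edge-irrefl G uw)))
    ... | no u≢r | yes refl = apart u≢r
    ... | no u≢r | no w≢r = proper (u≢r , w≢r , edge-irrefl G uw , inj₁ uw)
    distinguishing : Distinguishing G f
    distinguishing φ aut pres = fixes-all φ aut root sib
      where
      open Inverse φ using (to)
      root : to r ≡ r
      root with to r ≟ r
      ... | yes e = e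
      ... | no ne = contradiction (pres r) (apart ne)
      sib : ∀ w → w ≢ r → to w ≢ r → parent (to w) ≡ parent w → to w ≡ w
      sib w w≢r tw≢r e with to w ≟ w
      ... | yes p = p
      ... | no ne = contradiction (pres w) (proper (tw≢r , w≢r , ne , inj₂ e))

-- Colouring from given lists

module Lists (G : Graph) (conn : Connected G) (L : ListAssignment G) (L-unique : ∀ w → Unique (L w)) where

  private
    V = Fin (n G)
    Δ = maxDegree G

  open Removal ℕₚ._≟_

  module Rooted {r v : V} (rv : Edge G r v) where

    O : SearchOrder G r v
    O = searchOrder G rv conn

    open Search G rv O public
    open SearchOrder O using (τ; τ-injective; τ-root)

    τ≥1 : ∀ {w} → w ≢ r → 1 ≤ τ w
    τ≥1 {w} w≢r with τ w in e
    ... | zero = contradiction (τ-injective (trans e (sym τ-root))) w≢r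
    ... | suc _ = s≤s z≤n

    module _ {c₀ : ℕ} (c₀∈ : c₀ ∈ L r) where

      finish : ∀ g → (∀ {u w} → H u w → g u ≢ g w) → (∀ {u} → u ≢ r → g u ∈ L u ∖ c₀) →
        ProperlyLDistinguishable G L
      finish g proper mem = f , proj₁ PD , proj₂ PD , mem′
        where
        f = g [ r ≔ c₀ ]
        apart : ∀ {u} → u ≢ r → f u ≢ f r
        apart u≢r e = proj₂ (∈-∖⁻ {xs = L _} (mem u≢r)) (trans (sym (update-off g r u≢r)) (trans e (update-at g r)))
        proper′ : ∀ {u w} → H u w → f u ≢ f w
        proper′ h@(u≢r , w≢r , _) e = proper h (trans (sym (update-off g r u≢r)) (trans e (update-off g r w≢r)))
        PD = root-determines G rv O f proper′ apart
        mem′ : ∀ u → f u ∈ L u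
        mem′ u = by-cases (u ≟ r)
          where
          by-cases : Dec (u ≡ r) → f u ∈ L u
          by-cases (yes refl) = subst (_∈ L r) (sym (update-at g r)) c₀∈
          by-cases (no ne) = subst (_∈ L u) (sym (update-off g r ne)) (proj₁ (∈-∖⁻ {xs = L u} (mem ne)))

      module G₀ = Greedy (λ w → L w ∖ c₀) (λ w → ∖-unique (L-unique w))

      -- Without `c₀` the lists keep at least 2Δ - 2 colours, enough for every vertex after `v` in
      -- the order; the second hypothesis takes care of `v`.
      colour : (∀ w → Δ + Δ ≤ suc (length (L w))) → degH v < length (L v ∖ c₀) → ProperlyLDistinguishable G L
      colour large lt with G₀.complete (λ w _ → ≤-trans (large w) (s≤s (length-∖-unique (L-unique w)))) lt
      ... | g , proper , mem = finish g (λ h → proper (τ≥1 (proj₁ h)) (τ≥1 (proj₁ (proj₂ h))) h)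
        (λ u≢r → mem u≢r (τ≥1 u≢r))

  positive : ∀ {r v} → Edge G r v → 1 ≤ Δ
  positive {r} rv = ≤-trans (nonempty (∈-nbrs⁺ G rv)) (length-nbrs≤ G r)
    where
    nonempty : ∀ {x} {xs : List V} → x ∈ xs → 1 ≤ length xs
    nonempty (here _) = s≤s z≤n
    nonempty (there _) = s≤s z≤n

  some-∈ : ∀ {xs : List ℕ} → 1 ≤ length xs → ∃ λ c → c ∈ xs
  some-∈ {c ∷ _} _ = c , here refl

  large-lists : (∃ λ r → ∃ (Edge G r)) → (∀ w → Δ + Δ ≤ length (L w)) → ProperlyLDistinguishable G L
  large-lists (r , v , rv) large =
    colour c₀∈ (λ w → ≤-trans (large w) (ℕₚ.n≤1+n _))
      -- Without the colour of the root at least 2Δ - 1 colours remain at `v`, whose degree in `H`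
      -- is at most 2Δ - 2.
      (ℕₚ.≤-pred (≤-trans (degH≤ v≢r) (≤-trans (large v) (length-∖-unique (L-unique v)))))
    where
    open Rooted rv
    c₀∈ = proj₂ (some-∈ (≤-trans (positive rv) (≤-trans (ℕₚ.m≤m+n Δ Δ) (large r))))

  -- What the failure of all colourings implies

  module Stuck (large : ∀ w → Δ + Δ ≤ suc (length (L w))) (stuck : ¬ ProperlyLDistinguishable G L) where

    list-nonempty : ∀ {r v} → Edge G r v → ∃ λ c → c ∈ L r
    list-nonempty {r} rv = some-∈ (ℕₚ.≤-pred (≤-trans (ℕₚ.+-mono-≤ (positive rv) (positive rv)) (large r)))

    -- Any edge can provide the first two vertices of the order, and any colour of `L r` can be the
    -- root's. Each choice can fail only at `v`.
    tight : ∀ {r v} (rv : Edge G r v) {c₀} → c₀ ∈ L r → length (L v ∖ c₀) ≤ Rooted.degH rv v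
    tight rv c₀∈ = ℕₚ.≮⇒≥ (λ lt → stuck (Rooted.colour rv c₀∈ large lt))

    -- The chain bounds 2Δ by Δ plus the degree of `r`, and Δ is cancelled.
    regular : ∀ {r v} → Edge G r v → length (nbrs G r) ≡ Δ
    regular {r} {v} rv = ℕₚ.≤-antisym (length-nbrs≤ G r) (ℕₚ.+-cancelˡ-≤ Δ _ _ (begin
      Δ + Δ                                   ≤⟨ large v ⟩
      suc (length (L v))                      ≤⟨ s≤s (length-∖-unique (L-unique v)) ⟩
      2 + length (L v ∖ c₀)                   ≤⟨ s≤s (s≤s (tight rv c₀∈)) ⟩
      2 + Rooted.degH rv v                    ≤⟨ Rooted.degH-second rv ⟩
      length (nbrs G v) + length (nbrs G r)   ≤⟨ ℕₚ.+-monoˡ-≤ _ (length-nbrs≤ G v) ⟩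
      Δ + length (nbrs G r)                   ∎))
      where
      open ℕₚ.≤-Reasoning
      c₀ = proj₁ (list-nonempty rv)
      c₀∈ = proj₂ (list-nonempty rv)

    -- A colour missing from `L v` could be given to `r` without shortening the list of `v`, which
    -- would keep 2Δ - 1 colours against a degree of at most 2Δ - 2.
    common : ∀ {r v} → Edge G r v → ∀ {c} → c ∈ L r → c ∈ L v
    common {r} {v} rv {c} c∈ with DecMembership._∈?_ ℕₚ._≟_ c (L v)
    ... | yes c∈′ = c∈′
    ... | no c∉ = contradiction (begin
      1 + (Δ + Δ)                   ≤⟨ s≤s (large v) ⟩
      2 + length (L v)              ≤⟨ s≤s (s≤s (length-unique-⊆ (L-unique v) (λ x∈ → ∈-∖⁺ x∈ (λ {refl → c∉ x∈})))) ⟩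
      2 + length (L v ∖ c)          ≤⟨ s≤s (s≤s (tight rv c∈)) ⟩
      2 + Rooted.degH rv v          ≤⟨ Rooted.degH≤ rv (Rooted.v≢r rv) ⟩
      Δ + Δ                         ∎) (<-irrefl refl)
      where open ℕₚ.≤-Reasoning

    constant : ∀ u w {c} → c ∈ L u → c ∈ L w
    constant u w {c} = reachable-ind G {P = λ x → c ∈ L x} (λ c∈ e → common e c∈) (conn u w)

    -- By `degH-triangle` a triangle lowers the degree of `v` in `H` to at most 2Δ - 3, so a colour
    -- would be left for `v`.
    triangle-free : ∀ {u v w} → Edge G u v → Edge G u w → ¬ Edge G v w
    triangle-free {u} {v} {w} uv uw vw = contradiction (begin
      1 + (Δ + Δ)                             ≤⟨ s≤s (large v) ⟩
      2 + length (L v)                        ≤⟨ s≤s (s≤s (length-∖-unique (L-unique v))) ⟩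
      3 + length (L v ∖ c₀)                   ≤⟨ s≤s (s≤s (s≤s (tight uv c₀∈))) ⟩
      3 + Rooted.degH uv v                    ≤⟨ Rooted.degH-triangle uv uw vw ⟩
      length (nbrs G v) + length (nbrs G u)   ≤⟨ ℕₚ.+-mono-≤ (length-nbrs≤ G v) (length-nbrs≤ G u) ⟩
      Δ + Δ                                   ∎) (<-irrefl refl)
      where
      open ℕₚ.≤-Reasoning
      c₀ = proj₁ (list-nonempty uv)
      c₀∈ = proj₂ (list-nonempty uv)

    -- The two sides of an edge

    module Around {r v : V} (rv : Edge G r v) where

      open Rooted rv
      open Removal (_≟_ {n G}) using () renaming (free-element to free-vertex)

      c₀ : ℕ
      c₀ = proj₁ (list-nonempty rv)
      c₀∈ : c₀ ∈ L r
      c₀∈ = proj₂ (list-nonempty rv)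

      C : List ℕ
      C = L r ∖ c₀

      C-large : Δ + Δ ≤ 2 + length C
      C-large = ≤-trans (large r) (s≤s (length-∖-unique (L-unique r)))

      C⊆L : ∀ w {c} → c ∈ C → c ∈ L w ∖ c₀
      C⊆L w c∈ = let c∈L , ne = ∈-∖⁻ {xs = L r} c∈ in ∈-∖⁺ (constant r w c∈L) ne

      isolated-root : degH r ≡ 0
      isolated-root = ℕₚ.n≤0⇒n≡0 (count≤length (H? r) [] (λ h → contradiction refl (proj₁ h)))

      degH≤C : ∀ z → degH z ≤ length C
      degH≤C z = by-cases (z ≟ r)
        where
        by-cases : Dec (z ≡ r) → degH z ≤ length C
        by-cases (yes refl) = subst (_≤ length C) (sym isolated-root) z≤n
        by-cases (no z≢r) = ℕₚ.≤-pred (ℕₚ.≤-pred (≤-trans (degH≤ z≢r) C-large))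

      open Sliding H? H-sym H-irrefl C (∖-unique (L-unique r)) degH≤C
        (λ g proper mem → stuck (finish c₀∈ g proper (λ {u} _ → C⊆L u (mem u)))) public

      initial : ∀ {c} → c ∈ C → ∃ (Holed v)
      initial {c} c∈ with Greedy.greedy (λ _ → C) (λ _ → ∖-unique (L-unique r)) (λ _ _ → C-large)
      -- The root is isolated in `H`, but `Holed` asks for a colour from `C` there as well; any will
      -- do.
      ... | g , proper , mem = g [ r ≔ c ] , proper′ , mem′
        where
        proper′ : ∀ {u w} → u ≢ v → w ≢ v → H u w → (g [ r ≔ c ]) u ≢ (g [ r ≔ c ]) w
        proper′ u≢v w≢v h@(u≢r , w≢r , _) e = proper (τ≥2 u≢r u≢v) (τ≥2 w≢r w≢v) h
          (trans (sym (update-off g r u≢r)) (trans e (update-off g r w≢r)))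
        mem′ : ∀ {u} → u ≢ v → (g [ r ≔ c ]) u ∈ C
        mem′ {u} u≢v = by-cases (u ≟ r)
          where
          by-cases : Dec (u ≡ r) → (g [ r ≔ c ]) u ∈ C
          by-cases (yes refl) = subst (_∈ C) (sym (update-at g r)) c∈
          by-cases (no ne) = subst (_∈ C) (sym (update-off g r ne)) (mem ne (τ≥2 ne u≢v))

      X Y : V → Set
      X u = Edge G v u × u ≢ r
      Y u = Edge G r u × u ≢ v

      X? : Decidable X
      X? u = edge? G v u ×-dec ¬? (u ≟ r)
      Y? : Decidable Y
      Y? u = edge? G r u ×-dec ¬? (u ≟ v)

      H-X : ∀ {u} → X u → H v u
      H-X (vu , u≢r) = v≢r , u≢r , edge-irrefl G vu , inj₁ vu

      parent-Y : ∀ {u} → Y u → parent u ≡ r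
      parent-Y (ru , _) = parent-root ru

      parent-X : ∀ {u} → X u → parent u ≡ v
      parent-X (vu , _) = parent-second vu (λ ru → triangle-free rv ru vu)

      Y≢r : ∀ {u} → Y u → u ≢ r
      Y≢r (ru , _) = ≢-sym (edge-irrefl G ru)

      H-Y : ∀ {u} → Y u → H v u
      H-Y Yu = v≢r , Y≢r Yu , ≢-sym (proj₂ Yu) , inj₂ (trans (parent-root rv) (sym (parent-Y Yu)))

      split : ∀ {u} → H v u → X u ⊎ Y u
      split (_ , u≢r , _ , inj₁ vu) = inj₁ (vu , u≢r)
      split {u} (_ , _ , v≢u , inj₂ e) =
        inj₂ (edge-sym G (subst (Edge G u) (trans (sym e) (parent-root rv)) (parent-edge u)) , ≢-sym v≢u)

      disjoint : ∀ {u} → X u → ¬ Y u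
      disjoint (vu , _) (ru , _) = triangle-free rv ru vu

      X-clique : ∀ {u w} → X u → X w → u ≢ w → H u w
      X-clique Xu Xw ne = proj₂ Xu , proj₂ Xw , ne , inj₂ (trans (parent-X Xu) (sym (parent-X Xw)))

      Y-clique : ∀ {u w} → Y u → Y w → u ≢ w → H u w
      Y-clique Yu Yw ne = Y≢r Yu , Y≢r Yw , ne , inj₂ (trans (parent-Y Yu) (sym (parent-Y Yw)))

      ¬H-XY : ∀ {x y} → X x → Y y → ¬ Edge G x y → ¬ H x y
      ¬H-XY Xx Yy ¬xy (_ , _ , _ , inj₁ xy) = ¬xy xy
      ¬H-XY Xx Yy ¬xy (_ , _ , _ , inj₂ e) = v≢r (trans (sym (parent-X Xx)) (trans e (parent-Y Yy)))

      -- The edges between the neighbourhoods of `v` and `r` use up all degrees, so by connectedness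
      -- the two sets cover `G`. Each is independent, as there are no triangles.
      complete-bipartite : (∀ {x y} → X x → Y y → Edge G x y) → Isomorphic G (Kmm Δ)
      complete-bipartite all-adjacent = build (enumerate (nbrs-unique G v) (regular (edge-sym G rv)))
        (enumerate (nbrs-unique G r) (regular rv))
        where
        AB : ∀ {x y} → Edge G v x → Edge G r y → Edge G x y
        AB {x} {y} vx ry = by-cases (x ≟ r) (y ≟ v)
          where
          by-cases : Dec (x ≡ r) → Dec (y ≡ v) → Edge G x y
          by-cases (yes refl) _ = ry
          by-cases (no _) (yes refl) = edge-sym G vx
          by-cases (no x≢r) (no y≢v) = all-adjacent (vx , x≢r) (ry , y≢v)
        extend : ∀ {u w} → Edge G v u ⊎ Edge G r u → Edge G u w → Edge G v w ⊎ Edge G r w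
        extend {u} (inj₁ vu) uw = inj₂ (∈-nbrs⁻ G (saturate-nbrs G (nbrs-unique G r)
          (subst (length (nbrs G u) ≤_) (sym (regular rv)) (length-nbrs≤ G u)) (λ y∈ → AB vu (∈-nbrs⁻ G y∈)) uw))
        extend {u} (inj₂ ru) uw = inj₁ (∈-nbrs⁻ G (saturate-nbrs G (nbrs-unique G v)
          (subst (length (nbrs G u) ≤_) (sym (regular (edge-sym G rv))) (length-nbrs≤ G u))
          (λ x∈ → edge-sym G (AB (∈-nbrs⁻ G x∈) ru)) uw))
        covered : ∀ w → Edge G v w ⊎ Edge G r w
        covered w = reachable-ind G {P = λ x → Edge G v x ⊎ Edge G r x} extend (conn r w) (inj₁ (edge-sym G rv))
        Enumeration : List V → Set
        Enumeration xs = Σ (Fin Δ → V) λ f →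
          (∀ {i j} → f i ≡ f j → i ≡ j) × (∀ i → f i ∈ xs) × (∀ {x} → x ∈ xs → ∃ λ i → f i ≡ x)
        build : Enumeration (nbrs G v) → Enumeration (nbrs G r) → Isomorphic G (Kmm Δ)
        build (a , a-inj , a∈ , a-surj) (b , b-inj , b∈ , b-surj) = Kmm-from G a b a-inj b-inj
          (λ i j → AB (∈-nbrs⁻ G (a∈ i)) (∈-nbrs⁻ G (b∈ j)))
          (λ i j → triangle-free (∈-nbrs⁻ G (a∈ i)) (∈-nbrs⁻ G (a∈ j)))
          (λ i j → triangle-free (∈-nbrs⁻ G (b∈ i)) (∈-nbrs⁻ G (b∈ j)))
          (λ w → ⊎-map (λ e → a-surj (∈-nbrs⁺ G e)) (λ e → b-surj (∈-nbrs⁺ G e)) (covered w))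

      module NonAdjacent {x y : V} (Xx : X x) (Yy : Y y) (¬xy : ¬ Edge G x y) where

        Δ≥2 : 2 ≤ Δ
        Δ≥2 = ≤-trans (length-unique-⊆ {xs = v ∷ y ∷ []} ((≢-sym (proj₂ Yy) ∷ []) ∷ [] ∷ [])
          λ { (here refl) → ∈-nbrs⁺ G rv ; (there (here refl)) → ∈-nbrs⁺ G (proj₁ Yy) }) (length-nbrs≤ G r)

        abstract
          start-colouring : ∃ (Holed v)
          start-colouring = initial (proj₂ (some-∈ (ℕₚ.≤-pred (ℕₚ.≤-pred
            (≤-trans (ℕₚ.≤-trans (s≤s (s≤s (s≤s z≤n))) (ℕₚ.+-mono-≤ Δ≥2 Δ≥2)) C-large)))))

        -- By regularity `r` has a third neighbour, so every vertex of `Y` has a partner for the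
        -- exchange of colours.
        degree-≥3 : ¬ (3 ≤ Δ)
        degree-≥3 Δ≥3 = TwoCliques.impossible {v} {X} {Y} X? Y? split H-X H-Y disjoint X-clique Y-clique other
          {proj₁ start-colouring} (proj₂ start-colouring) {x} {y} Xx Yy (¬H-XY Xx Yy ¬xy)
          where
          other : ∀ {y} → Y y → ∃ λ y′ → Y y′ × y ≢ y′
          other {y} (_ , y≢v) =
            let y′ , y′∈ , y′∉ = free-vertex (nbrs-unique G r) (v ∷ y ∷ [])
                  (subst (3 ≤_) (sym (regular rv)) Δ≥3)
            in y′ , (∈-nbrs⁻ G y′∈ , λ e → y′∉ (here e)) , λ e → y′∉ (there (here (sym e)))

        -- The case of degree two

        module DegreeTwo (Δ≤2 : Δ ≤ 2) where

          degree≤2 : ∀ p → length (nbrs G p) ≤ 2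
          degree≤2 p = ≤-trans (length-nbrs≤ G p) Δ≤2

          two-neighbours : ∀ {p a b c} → Edge G p a → Edge G p b → a ≢ b → Edge G p c → c ≡ a ⊎ c ≡ b
          two-neighbours {p} {a} {b} {c} pa pb a≢b pc = read (saturate-nbrs G {xs = a ∷ b ∷ []}
            ((a≢b ∷ []) ∷ [] ∷ []) (degree≤2 p)
            (λ { (here refl) → pa ; (there (here refl)) → pb }) pc)
            where
            read : c ∈ a ∷ b ∷ [] → c ≡ a ⊎ c ≡ b
            read (here e) = inj₁ e
            read (there (here e)) = inj₂ e

          abstract
            other : ∀ {p a} → Edge G p a → ∃ λ b → Edge G p b × b ≢ a
            other {p} {a} pa =
              let b , b∈ , b∉ = free-vertex (nbrs-unique G p) (a ∷ []) (subst (2 ≤_) (sym (regular pa)) Δ≥2)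
              in b , ∈-nbrs⁻ G b∈ , λ e → b∉ (here e)

          vx : Edge G v x
          vx = proj₁ Xx
          ry : Edge G r y
          ry = proj₁ Yy

          x′ y′ : V
          x′ = proj₁ (other (edge-sym G vx))
          y′ = proj₁ (other (edge-sym G ry))
          xx′ : Edge G x x′
          xx′ = proj₁ (proj₂ (other (edge-sym G vx)))
          yy′ : Edge G y y′
          yy′ = proj₁ (proj₂ (other (edge-sym G ry)))
          x′≢v : x′ ≢ v
          x′≢v = proj₂ (proj₂ (other (edge-sym G vx)))
          y′≢r : y′ ≢ r
          y′≢r = proj₂ (proj₂ (other (edge-sym G ry)))

          around-r : ∀ {w} → Edge G r w → w ≡ v ⊎ w ≡ y
          around-r = two-neighbours rv ry (≢-sym (proj₂ Yy))
          around-v : ∀ {w} → Edge G v w → w ≡ r ⊎ w ≡ x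
          around-v = two-neighbours (edge-sym G rv) vx (≢-sym (proj₂ Xx))
          around-y : ∀ {w} → Edge G y w → w ≡ r ⊎ w ≡ y′
          around-y = two-neighbours (edge-sym G ry) yy′ (≢-sym y′≢r)

          x≢y : x ≢ y
          x≢y refl = disjoint Xx Yy
          ¬rx : ¬ Edge G r x
          ¬rx rx = triangle-free rv rx vx
          ¬vy : ¬ Edge G v y
          ¬vy = triangle-free rv ry
          x′≢y : x′ ≢ y
          x′≢y e = ¬xy (subst (Edge G x) e xx′)
          x′≢r : x′ ≢ r
          x′≢r e = ¬rx (edge-sym G (subst (Edge G x) e xx′))
          ¬rx′ : ¬ Edge G r x′
          ¬rx′ rx′ = [ x′≢v , x′≢y ]′ (around-r rx′)

          hexagon : Edge G y′ x′ → Isomorphic G C6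
          hexagon y′x′ = C6-from G conn degree≤2 (lookup cycle) (lookup-injective cycle-unique) edges
            where
            cycle : List V
            cycle = r ∷ v ∷ x ∷ x′ ∷ y′ ∷ y ∷ []
            y′≢v : y′ ≢ v
            y′≢v e = ¬vy (edge-sym G (subst (Edge G y) e yy′))
            y′≢x : y′ ≢ x
            y′≢x e = ¬xy (edge-sym G (subst (Edge G y) e yy′))
            cycle-unique : Unique cycle
            cycle-unique =
              (edge-irrefl G rv ∷ ≢-sym (proj₂ Xx) ∷ ≢-sym x′≢r ∷ ≢-sym y′≢r ∷ edge-irrefl G ry ∷ []) ∷
              (edge-irrefl G vx ∷ ≢-sym x′≢v ∷ ≢-sym y′≢v ∷ ≢-sym (proj₂ Yy) ∷ []) ∷
              (edge-irrefl G xx′ ∷ ≢-sym y′≢x ∷ x≢y ∷ []) ∷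
              (≢-sym (edge-irrefl G y′x′) ∷ x′≢y ∷ []) ∷
              (≢-sym (edge-irrefl G yy′) ∷ []) ∷ [] ∷ []
            edges : ∀ i → Edge G (lookup cycle i) (lookup cycle (next i))
            edges i₀ = rv
            edges i₁ = vx
            edges i₂ = xx′
            edges i₃ = edge-sym G y′x′
            edges i₄ = edge-sym G yy′
            edges i₅ = edge-sym G ry

          g : V → ℕ
          g = proj₁ start-colouring
          S : Holed v g
          S = proj₂ start-colouring

          -- The colour of the root is used a second time, at x′, and v gets the colour of its sibling y.
          abstract
            f : V → ℕ
            f = g [ v ≔ g y ] [ x′ ≔ c₀ ] [ r ≔ c₀ ]

            f-r : f r ≡ c₀
            f-r = update-at (g [ v ≔ g y ] [ x′ ≔ c₀ ]) r
            f-x′ : f x′ ≡ c₀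
            f-x′ = trans (update-off (g [ v ≔ g y ] [ x′ ≔ c₀ ]) r x′≢r) (update-at (g [ v ≔ g y ]) x′)
            f-inner : ∀ {u} → u ≢ r → u ≢ x′ → f u ≡ (g [ v ≔ g y ]) u
            f-inner u≢r u≢x′ = trans (update-off (g [ v ≔ g y ] [ x′ ≔ c₀ ]) r u≢r)
              (update-off (g [ v ≔ g y ]) x′ u≢x′)

          f-v : f v ≡ g y
          f-v = trans (f-inner v≢r (≢-sym x′≢v)) (update-at g v)
          f-off : ∀ {u} → u ≢ r → u ≢ x′ → u ≢ v → f u ≡ g u
          f-off u≢r u≢x′ u≢v = trans (f-inner u≢r u≢x′) (update-off g v u≢v)
          f-x : f x ≡ g x
          f-x = f-off (proj₂ Xx) (edge-irrefl G xx′) (≢-sym (edge-irrefl G vx))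
          f-y : f y ≡ g y
          f-y = f-off (Y≢r Yy) (≢-sym x′≢y) (proj₂ Yy)
          gx≢gy : g x ≢ g y
          gx≢gy e = x≢y (rainbow S (H-X Xx) (H-Y Yy) e)

          f-∈C : ∀ {u} → u ≢ r → u ≢ x′ → f u ∈ C
          f-∈C {u} u≢r u≢x′ = by-cases (u ≟ v)
            where
            by-cases : Dec (u ≡ v) → f u ∈ C
            by-cases (yes refl) = subst (_∈ C) (sym f-v) (proj₂ S (proj₂ Yy))
            by-cases (no u≢v) = subst (_∈ C) (sym (f-off u≢r u≢x′ u≢v)) (proj₂ S u≢v)

          f≢c₀ : ∀ {u} → u ≢ r → u ≢ x′ → f u ≢ c₀
          f≢c₀ u≢r u≢x′ = proj₂ (∈-∖⁻ {xs = L r} (f-∈C u≢r u≢x′))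

          c₀-vertices : ∀ {u} → f u ≡ c₀ → u ≡ r ⊎ u ≡ x′
          c₀-vertices {u} e = by-cases (u ≟ r) (u ≟ x′)
            where
            by-cases : Dec (u ≡ r) → Dec (u ≡ x′) → u ≡ r ⊎ u ≡ x′
            by-cases (yes p) _ = inj₁ p
            by-cases (no _) (yes p) = inj₂ p
            by-cases (no p) (no q) = contradiction e (f≢c₀ p q)

          f-∈L : ∀ u → f u ∈ L u
          f-∈L u = by-cases (u ≟ r) (u ≟ x′)
            where
            by-cases : Dec (u ≡ r) → Dec (u ≡ x′) → f u ∈ L u
            by-cases (yes refl) _ = subst (_∈ L r) (sym f-r) c₀∈
            by-cases (no _) (yes refl) = subst (_∈ L x′) (sym f-x′) (constant r x′ c₀∈)
            by-cases (no p) (no q) = proj₁ (∈-∖⁻ {xs = L u} (C⊆L u (f-∈C p q)))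

          proper-at-c₀ : ∀ {u w} → u ≡ r ⊎ u ≡ x′ → w ≡ r ⊎ w ≡ x′ → ¬ Edge G u w
          proper-at-c₀ (inj₁ refl) (inj₁ refl) e = edge-irrefl G e refl
          proper-at-c₀ (inj₁ refl) (inj₂ refl) e = ¬rx′ e
          proper-at-c₀ (inj₂ refl) (inj₁ refl) e = ¬rx′ (edge-sym G e)
          proper-at-c₀ (inj₂ refl) (inj₂ refl) e = edge-irrefl G e refl

          proper-at-v : ∀ {w} → w ≡ r ⊎ w ≡ x → f w ≢ f v
          proper-at-v (inj₁ refl) e = f≢c₀ v≢r (≢-sym x′≢v) (trans (sym e) f-r)
          proper-at-v (inj₂ refl) e = gx≢gy (trans (sym f-x) (trans e f-v))

          f-proper : Proper G f
          f-proper u w uw e = by-cases (f u ℕₚ.≟ c₀) (u ≟ v) (w ≟ v)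
            where
            off : ∀ {u} → f u ≢ c₀ → u ≢ r × u ≢ x′
            off ne = (λ { refl → ne f-r }) , λ { refl → ne f-x′ }
            by-cases : Dec (f u ≡ c₀) → Dec (u ≡ v) → Dec (w ≡ v) → ⊥
            by-cases (yes p) _ _ = proper-at-c₀ (c₀-vertices p) (c₀-vertices (trans (sym e) p)) uw
            by-cases (no _) (yes refl) _ = proper-at-v (around-v uw) (sym e)
            by-cases (no _) (no _) (yes refl) = proper-at-v (around-v (edge-sym G uw)) e
            by-cases (no p) (no u≢v) (no w≢v) =
              let u≢r , u≢x′ = off p
                  w≢r , w≢x′ = off (λ q → p (trans e q))
              in proj₁ S u≢v w≢v (u≢r , w≢r , edge-irrefl G uw , inj₁ uw)
                   (trans (sym (f-off u≢r u≢x′ u≢v)) (trans e (f-off w≢r w≢x′ w≢v)))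

          module _ (φ : V ↔ V) (aut : Automorphism G φ) (pres : ∀ u → f (Inverse.to φ u) ≡ f u) where

            open Inverse φ using (to)

            image-edge : ∀ {u w} → Edge G u w → Edge G (to u) (to w)
            image-edge {u} {w} uw = trans (sym (aut u w)) uw

            fixes-r : to r ≡ r
            fixes-r = by-cases (c₀-vertices (trans (pres r) f-r))
              where
              by-cases : to r ≡ r ⊎ to r ≡ x′ → to r ≡ r
              by-cases (inj₁ e) = e
              -- If `r` went to `x′`, then `v` and `y`, both of colour `g y`, would go to neighbours
              -- of `x′`. As `x` has another colour, both would land on the other neighbour.
              by-cases (inj₂ e) = contradiction
                (to-injective φ (trans (onto rv f-v) (sym (onto ry f-y)))) (≢-sym (proj₂ Yy))
                where
                x″ = other (edge-sym G xx′)
                onto : ∀ {w} → Edge G r w → f w ≡ g y → to w ≡ proj₁ x″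
                onto {w} rw fw = [ (λ p → contradiction (trans (sym f-x) (trans (subst (λ z → f z ≡ f w) p (pres w)) fw)) gx≢gy)
                                 , id ]′
                  (two-neighbours (edge-sym G xx′) (proj₁ (proj₂ x″)) (≢-sym (proj₂ (proj₂ x″)))
                    (subst (λ z → Edge G z (to w)) e (image-edge rw)))

            fixes-x′ : to x′ ≡ x′
            fixes-x′ = [ (λ e → contradiction (to-injective φ (trans e (sym fixes-r))) x′≢r) , id ]′
              (c₀-vertices (trans (pres x′) f-x′))

            -- The hypothesis includes the case `x′ ≡ y′`, in which `G` is a pentagon.
            module _ (¬y′x′ : ¬ Edge G y′ x′) where

              -- Otherwise `x` would go to `y′`, since `r` is fixed, and the edge from `x` to `x′`
              -- would go to one from `y′` to `x′`.
              ¬v↦y : to v ≢ y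
              ¬v↦y e = [ (λ p → proj₂ Xx (to-injective φ (trans p (sym fixes-r)))) ,
                         (λ p → ¬y′x′ (subst₂ (Edge G) p fixes-x′ (image-edge xx′))) ]′
                (around-y (subst (λ z → Edge G z (to x)) e (image-edge vx)))

              fixes-v : to v ≡ v
              fixes-v = [ id , (λ e → contradiction e ¬v↦y) ]′
                (around-r (subst (λ z → Edge G z (to v)) fixes-r (image-edge rv)))

              fixes-sibling : ∀ w → w ≢ r → to w ≢ r → parent (to w) ≡ parent w → to w ≡ w
              fixes-sibling w w≢r tw≢r e = by-cases (parent w ≟ r)
                where
                p = parent w
                pw : Edge G p w
                pw = edge-sym G (parent-edge w)
                ptw : Edge G p (to w)
                ptw = edge-sym G (subst (Edge G (to w)) e (parent-edge (to w)))
                by-cases : Dec (p ≡ r) → to w ≡ w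
                -- One of the two neighbours of `p` is its own parent, so `w` is its only child.
                by-cases (no p≢r) = [ (λ q → contradiction q ≢grandparent) , id ]′
                  (two-neighbours (parent-edge p) pw (≢-sym (child≢grandparent w≢r p≢r)) ptw)
                  where
                  ≢grandparent : to w ≢ parent p
                  ≢grandparent = subst (λ z → to w ≢ parent z) e (child≢grandparent tw≢r (subst (_≢ r) (sym e) p≢r))
                by-cases (yes p≡r) = at-root (around-r (subst (λ z → Edge G z w) p≡r pw))
                  (around-r (subst (λ z → Edge G z (to w)) p≡r ptw))
                  where
                  at-root : w ≡ v ⊎ w ≡ y → to w ≡ v ⊎ to w ≡ y → to w ≡ w
                  at-root (inj₁ refl) _ = fixes-v
                  at-root (inj₂ refl) (inj₁ q) = contradiction (to-injective φ (trans q (sym fixes-v))) (proj₂ Yy)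
                  at-root (inj₂ refl) (inj₂ q) = q

              fixes-everything : ∀ w → to w ≡ w
              fixes-everything = fixes-all φ aut fixes-r fixes-sibling

          is-hexagon : Isomorphic G C6
          is-hexagon = by-cases (edge? G y′ x′)
            where
            by-cases : Dec (Edge G y′ x′) → Isomorphic G C6
            by-cases (yes y′x′) = hexagon y′x′
            by-cases (no ¬y′x′) = contradiction
              (f , f-proper , (λ φ aut pres → fixes-everything φ aut pres ¬y′x′) , f-∈L) stuck

        non-adjacent⇒C6 : Isomorphic G C6
        non-adjacent⇒C6 = DegreeTwo.is-hexagon (ℕₚ.≤-pred (ℕₚ.≰⇒> degree-≥3))

      exceptional : Isomorphic G (Kmm Δ) ⊎ Isomorphic G C6
      exceptional = by-cases (any? λ x → any? λ y → X? x ×-dec Y? y ×-dec ¬? (edge? G x y))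
        where
        by-cases : Dec (∃ λ x → ∃ λ y → X x × Y y × ¬ Edge G x y) → Isomorphic G (Kmm Δ) ⊎ Isomorphic G C6
        by-cases (yes (x , y , Xx , Yy , ¬xy)) = inj₂ (NonAdjacent.non-adjacent⇒C6 Xx Yy ¬xy)
        by-cases (no ¬∃) = inj₁ (complete-bipartite λ {x} {y} Xx Yy → adjacent (edge? G x y) Xx Yy)
          where
          adjacent : ∀ {x y} → Dec (Edge G x y) → X x → Y y → Edge G x y
          adjacent (yes xy) _ _ = xy
          adjacent (no ¬xy) Xx Yy = contradiction (_ , _ , Xx , Yy , ¬xy) ¬∃

-- Decidability

-- Exhaustive search, with the value at 0 chosen first. A function rebuilt from its values agrees
-- with the original pointwise, so `P` has to respect pointwise equality.
choice? : ∀ {N} {A : Set} (Ls : Fin N → List A) {P : (Fin N → A) → Set} →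
  (∀ {f g} → (∀ i → f i ≡ g i) → P f → P g) → (∀ f → Dec (P f)) →
  Dec (∃ λ f → (∀ i → f i ∈ Ls i) × P f)
choice? {zero} {A} Ls {P} ext P? = map′ (λ p → none , (λ ()) , p) (λ (_ , _ , p) → ext (λ ()) p) (P? none)
  where
  none : Fin 0 → A
  none ()
choice? {suc N} {A} Ls {P} ext P? = map′ to from
  (Any? (λ c → choice? (Ls ∘ suc) (λ e → ext λ { zero → refl ; (suc i) → e i }) (λ f → P? (c ∷ᶠ f))) (Ls zero))
  where
  Rest : A → Set
  Rest c = ∃ λ f → (∀ i → f i ∈ Ls (suc i)) × P (c ∷ᶠ f)
  to : Any Rest (Ls zero) → ∃ λ f → (∀ i → f i ∈ Ls i) × P f
  to any = let c , c∈ , f , f∈ , p = find any in c ∷ᶠ f , (λ { zero → c∈ ; (suc i) → f∈ i }) , p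
  from : (∃ λ f → (∀ i → f i ∈ Ls i) × P f) → Any Rest (Ls zero)
  from (f , f∈ , p) = lose (f∈ zero) (f ∘ suc , f∈ ∘ suc , ext (λ { zero → refl ; (suc i) → refl }) p)

module _ (G : Graph) where

  private V = Fin (n G)

  -- A witness against `Distinguishing`; the bijection is split into `t` and its inverse `s`, each
  -- of which is searched for among finitely many functions.
  Moving : Coloring G → (V → V) → (V → V) → Set
  Moving f t s = (∀ x → t (s x) ≡ x) × (∀ x → s (t x) ≡ x) × (∀ u v → adj G u v ≡ adj G (t u) (t v)) ×
    (∀ v → f (t v) ≡ f v) × (∃ λ v → t v ≢ v)

  moving? : ∀ f t s → Dec (Moving f t s)
  moving? f t s = all? (λ x → t (s x) ≟ x) ×-dec all? (λ x → s (t x) ≟ x) ×-dec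
    all? (λ u → all? λ v → adj G u v Boolₚ.≟ adj G (t u) (t v)) ×-dec
    all? (λ v → f (t v) ℕₚ.≟ f v) ×-dec any? (λ v → ¬? (t v ≟ v))

  Moving-ext : ∀ {f t t′ s s′} → (∀ x → t x ≡ t′ x) → (∀ x → s x ≡ s′ x) → Moving f t s → Moving f t′ s′
  Moving-ext {f} {t} {t′} {s} {s′} et es (ts , st , aut , pres , v , ne) =
    (λ x → trans (sym (trans (cong t (es x)) (et (s′ x)))) (ts x)) ,
    (λ x → trans (sym (trans (cong s (et x)) (es (t′ x)))) (st x)) ,
    (λ u w → trans (aut u w) (cong₂ (adj G) (et u) (et w))) ,
    (λ x → trans (cong f (sym (et x))) (pres x)) ,
    v , λ e → ne (trans (et v) e)

  distinguishing? : ∀ f → Dec (Distinguishing G f)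
  distinguishing? f = map′ to from (¬? (choice? (λ _ → allFin (n G)) {P = Moved} ext
    (λ t → choice? (λ _ → allFin (n G)) {P = Moving f t} (Moving-ext (λ _ → refl)) (moving? f t))))
    where
    Moved : (V → V) → Set
    Moved t = ∃ λ s → (∀ i → s i ∈ allFin (n G)) × Moving f t s
    ext : ∀ {t t′} → (∀ i → t i ≡ t′ i) → Moved t → Moved t′
    ext e (s , s∈ , m) = s , s∈ , Moving-ext e (λ _ → refl) m
    to : ¬ (∃ λ t → (∀ i → t i ∈ allFin (n G)) × Moved t) → Distinguishing G f
    to ¬moved φ aut pres v = decidable-stable (Inverse.to φ v ≟ v) λ ne → ¬moved
      (Inverse.to φ , (λ i → ∈-allFin _) , Inverse.from φ , (λ i → ∈-allFin _) ,
       Inverse.strictlyInverseˡ φ , Inverse.strictlyInverseʳ φ , aut , pres , v , ne)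
    from : Distinguishing G f → ¬ (∃ λ t → (∀ i → t i ∈ allFin (n G)) × Moved t)
    from dist (t , _ , s , _ , ts , st , aut , pres , v , ne) = ne (dist (mk↔ₛ′ t s ts st) aut pres v)

  Good : Coloring G → Set
  Good f = Proper G f × Distinguishing G f

  good? : ∀ f → Dec (Good f)
  good? f = all? (λ u → all? λ v → edge? G u v →-dec ¬? (f u ℕₚ.≟ f v)) ×-dec distinguishing? f

  Good-ext : ∀ {f g} → (∀ i → f i ≡ g i) → Good f → Good g
  Good-ext e (proper , dist) =
    (λ u v uv p → proper u v uv (trans (e u) (trans p (sym (e v))))) ,
    λ φ aut pres → dist φ aut (λ v → trans (e _) (trans (pres v) (sym (e v))))

  properlyLDistinguishable? : ∀ L → Dec (ProperlyLDistinguishable G L)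
  properlyLDistinguishable? L = map′ (λ (f , mem , p , d) → f , p , d , mem) (λ (f , p , d , mem) → f , mem , p , d)
    (choice? L Good-ext good?)

-- Bounding the colours

words : ℕ → ℕ → List (List ℕ)
words N zero = [] ∷ []
words N (suc k) = cartesianProductWith _∷_ (upTo N) (words N k)

∈-words : ∀ {N} xs → (∀ {x} → x ∈ xs → x < N) → xs ∈ words N (length xs)
∈-words [] _ = here refl
∈-words (x ∷ xs) lt = ∈-cartesianProductWith⁺ _∷_ (∈-upTo⁺ (lt (here refl))) (∈-words xs (lt ∘ there))

words-length : ∀ {N} k {xs} → xs ∈ words N k → length xs ≡ k
words-length zero (here refl) = refl
words-length {N} (suc k) xs∈ with ∈-cartesianProductWith⁻ _∷_ (upTo N) (words N k) xs∈
... | _ , _ , _ , ys∈ , refl = cong suc (words-length k ys∈)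

-- Returning c at the end of the list, and not a default value, makes the renaming injective on all of ℕ.
position : List ℕ → ℕ → ℕ
position [] c = c
position (x ∷ cs) c with c ℕₚ.≟ x
... | yes _ = 0
... | no _ = suc (position cs c)

position-injective : ∀ cs {c d} → position cs c ≡ position cs d → c ≡ d
position-injective [] e = e
position-injective (x ∷ cs) {c} {d} e with c ℕₚ.≟ x | d ℕₚ.≟ x
... | yes p | yes q = trans p (sym q)
... | no _ | no _ = position-injective cs (ℕₚ.suc-injective e)

position< : ∀ {cs c} → c ∈ cs → position cs c < length cs
position< {x ∷ cs} {c} c∈ with c ℕₚ.≟ x | c∈
... | yes _ | _ = s≤s z≤n
... | no ne | here e = contradiction e ne
... | no _ | there p = s≤s (position< p)

length-concatMap : ∀ {A B : Set} {f : A → List B} {k} → (∀ x → length (f x) ≡ k) →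
  ∀ xs → length (concatMap f xs) ≡ length xs * k
length-concatMap eq [] = refl
length-concatMap {f = f} eq (x ∷ xs) = trans (length-++ (f x)) (cong₂ _+_ (eq x) (length-concatMap eq xs))

module _ (G : Graph) where

  private V = Fin (n G)

  -- Colours are pulled back along `ρ`. As `f` is `ρ` after `g`, vertices with equal colours under
  -- `g` have equal colours under `f`, so both conditions pass to `g`.
  relabel : ∀ {L : ListAssignment G} (ρ : ℕ → ℕ) → ProperlyLDistinguishable G (λ v → map ρ (L v)) →
    ProperlyLDistinguishable G L
  relabel {L} ρ (f , proper , dist , mem) = g , (λ u v uv e → proper u v uv (lift e)) ,
    (λ φ aut pres → dist φ aut (λ v → lift (pres v))) , λ v → proj₁ (proj₂ (preimage v))
    where
    preimage : ∀ v → ∃ λ c → c ∈ L v × f v ≡ ρ c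
    preimage v = ∈-map⁻ ρ (mem v)
    g : Coloring G
    g v = proj₁ (preimage v)
    lift : ∀ {u v} → g u ≡ g v → f u ≡ f v
    lift {u} {v} e = trans (proj₂ (proj₂ (preimage u))) (trans (cong ρ e) (sym (proj₂ (proj₂ (preimage v)))))

  listDist? : ∀ k → Dec (ListDist G k)
  listDist? k = map′ to from (¬? (choice? (λ _ → words N k) {P = Bad} ext bad?))
    where
    -- The number of entries in all lists together: colours are renamed to their positions in the
    -- concatenation.
    N = length (allFin (n G)) * k
    Bad : ListAssignment G → Set
    Bad L = (∀ v → Unique (L v)) × ¬ ProperlyLDistinguishable G L
    bad? : ∀ L → Dec (Bad L)
    bad? L = all? (λ v → unique? (L v)) ×-dec ¬? (properlyLDistinguishable? G L)
    ext : ∀ {L M} → (∀ v → L v ≡ M v) → Bad L → Bad M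
    ext e (uniq , ¬pld) = (λ v → subst Unique (e v) (uniq v)) ,
      λ (f , p , d , mem) → ¬pld (f , p , d , λ v → subst (f v ∈_) (sym (e v)) (mem v))
    to : ¬ (∃ λ L → (∀ v → L v ∈ words N k) × Bad L) → ListDist G k
    to ¬bad L size = relabel ρ (decidable-stable (properlyLDistinguishable? G L′)
      λ ¬pld → ¬bad (L′ , L′∈ , (λ v → map⁺ (position-injective cs) (proj₁ (size v))) , ¬pld))
      where
      cs = concatMap L (allFin (n G))
      ρ = position cs
      L′ : ListAssignment G
      L′ v = map ρ (L v)
      below : ∀ v {c} → c ∈ L′ v → c < N
      below v c∈ = let d , d∈ , e = ∈-map⁻ ρ c∈ in
        subst₂ _<_ (sym e) (length-concatMap (λ v → proj₂ (size v)) (allFin (n G)))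
          (position< (∈-concatMap⁺ L (lose (∈-allFin v) d∈)))
      L′∈ : ∀ v → L′ v ∈ words N k
      L′∈ v = subst (λ m → L′ v ∈ words N m) (trans (length-map ρ (L v)) (proj₂ (size v))) (∈-words (L′ v) (below v))
    from : ListDist G k → ¬ (∃ λ L → (∀ v → L v ∈ words N k) × Bad L)
    from dist (L , L∈ , uniq , ¬pld) = ¬pld (dist L (λ v → uniq v , words-length k (L∈ v)))

least : {P : ℕ → Set} → Decidable P → ∀ m → P m → ∃ λ k → P k × k ≤ m × (∀ j → j < k → ¬ P j)
least P? zero p = 0 , p , z≤n , λ _ ()
least {P} P? (suc m) p with P? 0
... | yes p₀ = 0 , p₀ , z≤n , λ _ ()
... | no ¬p₀ = let k , pk , k≤m , below = least (P? ∘ suc) m p in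
  suc k , pk , s≤s k≤m , λ { zero _ → ¬p₀ ; (suc j) (s≤s lt) → below j lt }

-- Lower bounds

transpose-cases : ∀ {N} (u w z : Fin N) → let t = Inverse.to (transpose u w) z in
  (z ≡ u × t ≡ w) ⊎ (z ≡ w × t ≡ u) ⊎ t ≡ z
transpose-cases u w z with z ≟ u
... | yes p = inj₁ (p , refl)
... | no _ with z ≟ w
...   | yes q = inj₂ (inj₁ (q , refl))
...   | no _ = inj₂ (inj₂ refl)

transpose-at : ∀ {N} (u w : Fin N) → Inverse.to (transpose u w) u ≡ w
transpose-at u w with u ≟ u
... | yes _ = refl
... | no ne = contradiction refl ne

module _ (G : Graph) where

  private V = Fin (n G)

  -- Equal lists turn list colouring into ordinary colouring with `k` colours.
  few-colours : ∀ {k} → ListDist G k → ∃ λ f → Proper G f × Distinguishing G f × (∀ v → f v < k)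
  few-colours {k} dist = let f , proper , d , mem = dist (λ _ → upTo k) (λ _ → upTo⁺ k , length-upTo k) in
    f , proper , d , λ v → ∈-upTo⁻ (mem v)

  -- Exchanging twins is an automorphism, and it preserves `f` if their colours agree.
  twins-distinguished : ∀ {f u w} → Distinguishing G f → (∀ z → adj G u z ≡ adj G w z) → f u ≡ f w → u ≡ w
  twins-distinguished {f} {u} {w} dist twins fu≡fw = trans (sym (dist (transpose u w) aut pres u)) (transpose-at u w)
    where
    t : V → V
    t = Inverse.to (transpose u w)
    row : ∀ x z → adj G (t x) z ≡ adj G x z
    row x z with transpose-cases u w x
    ... | inj₁ (refl , e) = trans (cong (λ y → adj G y z) e) (sym (twins z))
    ... | inj₂ (inj₁ (refl , e)) = trans (cong (λ y → adj G y z) e) (twins z)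
    ... | inj₂ (inj₂ e) = cong (λ y → adj G y z) e
    aut : Automorphism G (transpose u w)
    aut x y = trans (sym (row x y)) (trans (Graph.sym G (t x) y)
      (trans (sym (row y (t x))) (Graph.sym G (t y) (t x))))
    pres : ∀ x → f (t x) ≡ f x
    pres x with transpose-cases u w x
    ... | inj₁ (refl , e) = trans (cong f e) (sym fu≡fw)
    ... | inj₂ (inj₁ (refl , e)) = trans (cong f e) fu≡fw
    ... | inj₂ (inj₂ e) = cong f e

  -- Two vertices on the same side are twins, and two on different sides are adjacent; so all
  -- `m + m` colours would have to be different.
  Kmm-lower : ∀ {m k} → Isomorphic G (Kmm m) → k < m + m → ¬ ListDist G k
  Kmm-lower {m} {k} (φ , iso) lt dist with few-colours dist
  ... | f , proper , d , below = absurd (pigeonhole lt colour)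
    where
    open Inverse φ using (to; from; strictlyInverseˡ)
    colour : Fin (m + m) → Fin k
    colour i = fromℕ< (below (from i))
    same : ∀ {i j} → colour i ≡ colour j → f (from i) ≡ f (from j)
    same e = trans (sym (toℕ-fromℕ< (below _))) (trans (cong toℕ e) (toℕ-fromℕ< (below _)))
    row : ∀ i z → adj G (from i) z ≡ left m i xor left m (to z)
    row i z = trans (iso (from i) z) (cong (λ x → left m x xor left m (to z)) (strictlyInverseˡ i))
    apart : ∀ {a b} → a ≢ b → a xor b ≡ true
    apart {false} {false} ne = contradiction refl ne
    apart {false} {true} ne = refl
    apart {true} {false} ne = refl
    apart {true} {true} ne = contradiction refl ne
    absurd : ¬ (∃ λ i → ∃ λ j → i Fin.< j × colour i ≡ colour j)
    absurd (i , j , i<j , e) = by-cases (left m i Boolₚ.≟ left m j)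
      where
      by-cases : Dec (left m i ≡ left m j) → ⊥
      by-cases (yes p) = <⇒≢ i<j (trans (sym (strictlyInverseˡ i)) (trans
        (cong to (twins-distinguished d
          (λ z → trans (row i z) (trans (cong (_xor left m (to z)) p) (sym (row j z)))) (same e)))
        (strictlyInverseˡ j)))
      by-cases (no ne) = proper (from i) (from j)
        (trans (row i (from j)) (trans (cong (λ x → left m i xor left m x) (strictlyInverseˡ j)) (apart ne))) (same e)

-- Only the half-turn and the reflections through vertices: a reflection through edges swaps adjacent vertices.
symmetry : Fin 4 → Fin 6 → Fin 6
symmetry zero i = next (next (next i))
symmetry (suc zero) i = lookup (i₀ ∷ i₅ ∷ i₄ ∷ i₃ ∷ i₂ ∷ i₁ ∷ []) i
symmetry (suc (suc zero)) i = lookup (i₂ ∷ i₁ ∷ i₀ ∷ i₅ ∷ i₄ ∷ i₃ ∷ []) i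
symmetry (suc (suc (suc zero))) i = lookup (i₄ ∷ i₃ ∷ i₂ ∷ i₁ ∷ i₀ ∷ i₅ ∷ []) i

symmetry-spec : ∀ s → (∀ i → symmetry s (symmetry s i) ≡ i) ×
  (∀ i j → adj C6 i j ≡ adj C6 (symmetry s i) (symmetry s j)) × (∃ λ i → symmetry s i ≢ i)
symmetry-spec = from-yes (all? λ s → all? (λ i → symmetry s (symmetry s i) ≟ i) ×-dec
  all? (λ i → all? λ j → adj C6 i j Boolₚ.≟ adj C6 (symmetry s i) (symmetry s j)) ×-dec
  any? (λ i → ¬? (symmetry s i ≟ i)))

three-colours-list : ∀ a b c d e g → let h = lookup {A = Fin 3} (a ∷ b ∷ c ∷ d ∷ e ∷ g ∷ []) in
  (∃ λ i → h i ≡ h (next i)) ⊎ (∃ λ s → ∀ i → h (symmetry s i) ≡ h i)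
three-colours-list = from-yes (all? λ a → all? λ b → all? λ c → all? λ d → all? λ e → all? λ g →
  let h = lookup {A = Fin 3} (a ∷ b ∷ c ∷ d ∷ e ∷ g ∷ []) in
  any? (λ i → h i ≟ h (next i)) ⊎-dec any? (λ s → all? λ i → h (symmetry s i) ≟ h i))

three-colours : (h : Fin 6 → Fin 3) → (∃ λ i → h i ≡ h (next i)) ⊎ (∃ λ s → ∀ i → h (symmetry s i) ≡ h i)
three-colours h = ⊎-map (λ (i , e) → i , trans (sym (same i)) (trans e (same (next i))))
  (λ (s , e) → s , λ i → trans (sym (same (symmetry s i))) (trans (e i) (same i)))
  (three-colours-list (h i₀) (h i₁) (h i₂) (h i₃) (h i₄) (h i₅))
  where
  same : ∀ i → lookup (h i₀ ∷ h i₁ ∷ h i₂ ∷ h i₃ ∷ h i₄ ∷ h i₅ ∷ []) i ≡ h i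
  same = λ { i₀ → refl ; i₁ → refl ; i₂ → refl ; i₃ → refl ; i₄ → refl ; i₅ → refl }

module _ (G : Graph) (hexagon : Isomorphic G C6) where

  private
    V = Fin (n G)
    φ = proj₁ hexagon
    iso = proj₂ hexagon

  open Inverse φ using (to; from; strictlyInverseˡ; strictlyInverseʳ)

  -- This turns `k < 2 * maxDegree G` into `k ≤ 3`.
  C6-maxDegree : maxDegree G ≤ 2
  C6-maxDegree = maxDegree≤ G (λ v → subst (_≤ 2) (sym (degree≡length-nbrs G v)) (bound v))
    where
    bound : ∀ v → length (nbrs G v) ≤ 2
    bound v = subst (_≤ 2) (length-map to (nbrs G v))
      (length-unique-⊆ (map⁺ (to-injective φ) (nbrs-unique G v)) cover)
      where
      cover : ∀ {x} → x ∈ map to (nbrs G v) → x ∈ next (to v) ∷ prev (to v) ∷ []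
      cover x∈ with ∈-map⁻ to x∈
      ... | w , w∈ , refl with C6-edges (to v) (to w)
      ...   | inj₁ (_ , inj₁ e) = here e
      ...   | inj₁ (_ , inj₂ e) = there (here e)
      ...   | inj₂ (e , _) with trans (sym (∈-nbrs⁻ G w∈)) (trans (iso v w) e)
      ...     | ()

  C6-lower : ∀ {k} → k ≤ 3 → ¬ ListDist G k
  C6-lower {k} k≤3 dist with few-colours G dist
  ... | f , proper , d , below = [ monochromatic , symmetric ]′ (three-colours colour)
    where
    colour : Fin 6 → Fin 3
    colour i = fromℕ< (≤-trans (below (from i)) k≤3)
    same : ∀ {i j} → colour i ≡ colour j → f (from i) ≡ f (from j)
    same e = trans (sym (toℕ-fromℕ< (≤-trans (below _) k≤3)))
      (trans (cong toℕ e) (toℕ-fromℕ< (≤-trans (below _) k≤3)))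
    adj-from : ∀ i j → adj G (from i) (from j) ≡ adj C6 i j
    adj-from i j = trans (iso (from i) (from j)) (cong₂ (adj C6) (strictlyInverseˡ i) (strictlyInverseˡ j))
    monochromatic : ¬ (∃ λ i → colour i ≡ colour (next i))
    monochromatic (i , e) = proper (from i) (from (next i)) (trans (adj-from i (next i)) edge) (same e)
      where
      edge : adj C6 i (next i) ≡ true
      edge with C6-edges i (next i)
      ... | inj₁ (t , _) = t
      ... | inj₂ (_ , ne , _) = contradiction refl ne
    symmetric : ¬ (∃ λ s → ∀ i → colour (symmetry s i) ≡ colour i)
    symmetric (s , pres) = let i , ne = moved in ne (trans (sym (strictlyInverseˡ (symmetry s i)))
        (trans (cong to (trans (cong (λ x → from (symmetry s x)) (sym (strictlyInverseˡ i)))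
          (d ψ aut (λ v → trans (same (pres (to v))) (cong f (strictlyInverseʳ v))) (from i)))) (strictlyInverseˡ i)))
      where
      σ = symmetry s
      involutive = proj₁ (symmetry-spec s)
      moved = proj₂ (proj₂ (symmetry-spec s))
      t : V → V
      t v = from (σ (to v))
      t-involutive : ∀ v → t (t v) ≡ v
      t-involutive v = trans (cong (from ∘ σ) (strictlyInverseˡ (σ (to v))))
        (trans (cong from (involutive (to v))) (strictlyInverseʳ v))
      ψ : V ↔ V
      ψ = mk↔ₛ′ t t t-involutive t-involutive
      aut : Automorphism G ψ
      aut u v = trans (iso u v)
        (trans (proj₁ (proj₂ (symmetry-spec s)) (to u) (to v)) (sym (adj-from (σ (to u)) (σ (to v)))))

-- The value of the list-distinguishing chromatic number

some-edge : (G : Graph) → 2 ≤ n G → Connected G → ∃ λ r → ∃ (Edge G r)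
some-edge G 2≤n conn = leave (conn (fromℕ< (≤-trans (s≤s z≤n) 2≤n)) (fromℕ< 2≤n)) distinct
  where
  distinct : fromℕ< (≤-trans (s≤s z≤n) 2≤n) ≢ fromℕ< 2≤n
  distinct e with trans (sym (toℕ-fromℕ< (≤-trans (s≤s z≤n) 2≤n))) (trans (cong toℕ e) (toℕ-fromℕ< 2≤n))
  ... | ()
  leave : ∀ {u w} → Reachable G u w → u ≢ w → ∃ λ r → ∃ (Edge G r)
  leave here ne = contradiction refl ne
  leave (step e _) _ = _ , _ , e

2*-+ : ∀ d → 2 * d ≡ d + d
2*-+ d = cong (d +_) (ℕₚ.+-identityʳ d)

theorem3p1 : (G : Graph) → 2 ≤ n G → Connected G →
    (¬ (Isomorphic G (Kmm (maxDegree G)) ⊎ Isomorphic G C6) →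
    Σ ℕ λ m → IsChiDL G m × m ≤ 2 * maxDegree G ∸ 1)
    × (Isomorphic G (Kmm (maxDegree G)) ⊎ Isomorphic G C6 →
    IsChiDL G (2 * maxDegree G))
theorem3p1 G 2≤n conn = generic , λ exc → upper , lower exc
  where
  Δ = maxDegree G
  edge = some-edge G 2≤n conn
  upper : ListDist G (2 * Δ)
  upper L size = Lists.large-lists G conn L (λ w → proj₁ (size w)) edge
    (λ w → ℕₚ.≤-reflexive (trans (sym (2*-+ Δ)) (sym (proj₂ (size w)))))
  lower : Isomorphic G (Kmm Δ) ⊎ Isomorphic G C6 → ∀ k → k < 2 * Δ → ¬ ListDist G k
  lower (inj₁ iso) k lt = Kmm-lower G {Δ} iso (subst (k <_) (2*-+ Δ) lt)
  lower (inj₂ iso) k lt = C6-lower G iso (ℕₚ.≤-pred (≤-trans lt (ℕₚ.*-monoʳ-≤ 2 (C6-maxDegree G iso))))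
  generic : ¬ (Isomorphic G (Kmm Δ) ⊎ Isomorphic G C6) → Σ ℕ λ m → IsChiDL G m × m ≤ 2 * Δ ∸ 1
  generic ¬exc = let m , dist , m≤ , below = least (listDist? G) (2 * Δ ∸ 1) tight in m , (dist , below) , m≤
    where
    tight : ListDist G (2 * Δ ∸ 1)
    -- What is refuted is the absence of a colouring; decidability turns this into a colouring.
    tight L size = decidable-stable (properlyLDistinguishable? G L) λ stuck →
      ¬exc (Lists.Stuck.Around.exceptional G conn L (λ w → proj₁ (size w)) large stuck (proj₂ (proj₂ edge)))
      where
      large : ∀ w → Δ + Δ ≤ suc (length (L w))
      large w = subst₂ _≤_ (2*-+ Δ) (cong suc (sym (proj₂ (size w)))) (ℕₚ.m≤n+m∸n (2 * Δ) 1)
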